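{- Let $\{a_n\}_{n\ge0}$ and $\{b_n\}_{n\ge0}$ be the sequences satisfying, for all $n\ge0$, $$(n+2)^3u_{n+2}-8(2n+3)(2n^2+6n+5)u_{n+1}+256(n+1)^3u_n=0\quad(u_n=a_n\text{ or }b_n)$$ with initial values $a_0=1$, $a_1=8$, $b_0=0$, $b_1=1$. Then $$\left|\frac{b_n}{a_n}-\frac7{16}\zeta(3)\right|\ll\frac1{\log n}$$ as $n\to\infty$.
   Context: $\zeta$ is the Riemann zeta function. $X_n\ll Y_n$ means $|X_n|\le CY_n$ for some constant $C$ and all large $n$. -}

module Defs where

open import Data.Nat using (ℕ; zero; suc) renaming (_+_ to _+ℕ_; _*_ to _*ℕ_)
open import Data.Nat.Logarithm using (⌊log₂_⌋)
open import Data.Integer using (+_)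
open import Data.Rational using (ℚ; _÷_; ≢-nonZero; 0ℚ; _+_; _*_; _-_; _/_; _≤_; _<_; ∣_∣)
open import Data.Product using (∃-syntax)
open import Relation.Binary.PropositionalEquality using (_≡_; _≢_)

ℕ→ℚ : ℕ → ℚ
ℕ→ℚ n = + n / 1

Recurrence : (ℕ → ℚ) → Set
Recurrence u = ∀ (n : ℕ) →
  let m = ℕ→ℚ n in
  (m + ℕ→ℚ 2) * (m + ℕ→ℚ 2) * (m + ℕ→ℚ 2) * u (suc (suc n))
  - ℕ→ℚ 8 * (ℕ→ℚ 2 * m + ℕ→ℚ 3) * (ℕ→ℚ 2 * m * m + ℕ→ℚ 6 * m + ℕ→ℚ 5) * u (suc n)
  + ℕ→ℚ 256 * (m + ℕ→ℚ 1) * (m + ℕ→ℚ 1) * (m + ℕ→ℚ 1) * u n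
  ≡ 0ℚ

zeta3Partial : ℕ → ℚ
zeta3Partial zero = 0ℚ
zeta3Partial (suc M) = zeta3Partial M + (+ 1) / (suc M *ℕ suc M *ℕ suc M)

-- zeta(3) is the limit of the increasing sequence zeta3Partial M.
-- For rationals c ≥ 0, x, L ≥ 0, E, the real inequality  L * |x - c·ζ(3)| ≤ E
-- holds iff both
--   (i)  L * (c·S_M - x) ≤ E for all M     (since S_M ↑ ζ(3)), and
--   (ii) for every δ > 0 there is M with L * (x - c·S_M) ≤ E + δ.
-- This is just the unfolding of ζ(3) = lim S_M (sup of increasing sequence).
ScaledDistZeta3≤ : (L c x E : ℚ) → Set
ScaledDistZeta3≤ L c x E =
  (∀ (M : ℕ) → L * (c * zeta3Partial M - x) ≤ E)
  × (∀ (δ : ℚ) → 0ℚ < δ → ∃[ M ] (L * (x - c * zeta3Partial M) ≤ E + δ))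
  where open import Data.Product using (_×_)

ratio : (p q : ℚ) → q ≢ 0ℚ → ℚ
ratio p q q≢0 = _÷_ p q {{≢-nonZero q≢0}}

{-# OPTIONS --safe #-}

-- An Apéry-type construction works with the rational functions
-- [(s+½)(s+3/2)⋯(s+n-½) / (s(s+1)⋯(s+n))]², whose derivative, summed over the half-integers
-- s > 0, is a small linear form in 1 and ζ(3).  Up to constants, T n i below is minus this
-- derivative at s = i + ½.  Creative telescoping shows that Sₙ = ∑ᵢ T n i satisfies the
-- recurrence divided by 16ⁿ, and comparing n = 0, 1 gives
-- Sₙ = (7/8) ζ(3) aₙ/16ⁿ - 2 bₙ/16ⁿ.  Termwise estimates give 0 ≤ (n+1) Sₙ ≤ 3/2, whereas the
-- recurrence forces (n+1) aₙ/16ⁿ to grow like log n; the quotient is O(1/log n).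
-- Since ζ(3) is only given through its partial sums, the identity for Sₙ is used in the form
-- truncated at M, with an error that is O(1/M) for each fixed n.

module Submission where

open import Defs
open import Defs using () renaming (ℕ→ℚ to ι)
open import Data.Nat using (ℕ; zero; suc; z≤n; s≤s; _∸_; ⌊_/2⌋; ⌈_/2⌉) renaming (_+_ to _+ℕ_; _*_ to _*ℕ_; _≤_ to _≤ℕ_)
import Data.Nat as ℕ
open import Data.Nat.Induction using (<-rec)
open import Data.Nat.Logarithm using (⌊log₂_⌋; ⌊log₂⌊n/2⌋⌋≡⌊log₂n⌋∸1)
import Data.Nat.Properties as ℕₚ
open import Data.Integer using (+_)
import Data.Integer as ℤ
import Data.Integer.Properties as ℤₚ
open import Data.Rational using (ℚ; 0ℚ; 1ℚ; ½; _/_; _+_; _*_; _-_; -_; _≤_; ∣_∣; nonNegative; toℚᵘ; fromℚᵘ; ↥_; ≢-nonZero; *≤*)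
open import Data.Rational.Properties
open import Data.Rational.Unnormalised using (mkℚᵘ) renaming (_+_ to _+ᵘ_; _*_ to _*ᵘ_)
import Data.Rational.Unnormalised as ℚᵘ
import Data.Rational.Unnormalised.Properties as ℚᵘₚ
open import Data.Product using (Σ; ∃-syntax; _,_; proj₁; proj₂; _×_)
open import Data.Sum using (inj₁; inj₂)
open import Relation.Nullary using (¬_; dec⇒maybe)
open import Relation.Binary.PropositionalEquality using (_≡_; _≢_; refl; sym; trans; cong; cong₂; subst; module ≡-Reasoning)
open import Tactic.RingSolver using (solve-∀)
open import Tactic.RingSolver.Core.AlmostCommutativeRing using (AlmostCommutativeRing; fromCommutativeRing)

-- The characteristic polynomial x² - 32x + 256 has the double root 16, so no exponential factor
-- separates the solutions and the whole gain is a logarithm. Hence the two estimates in the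
-- quotient must be uniform in n, while the truncation error may depend on n arbitrarily, because M
-- is chosen after n. Differentiation is replaced by algebra: the telescoping identity for w² and
-- its formal derivative become two polynomial identities, recombined with the logarithmic
-- derivative as an extra variable. The ring solver knows no inverses, so each reciprocal is an atom
-- x with a single relation `x * d ≡ 1ℚ`. This shapes the equational chains: one polynomial identity
-- isolates the products x * d, a congruence replaces them by `1ℚ` or inserts them, and another
-- polynomial identity finishes.

ℚ-ring : AlmostCommutativeRing _ _
ℚ-ring = fromCommutativeRing +-*-commutativeRing λ x → dec⇒maybe (0ℚ ≟ x)

open import Tactic.RingSolver.NonReflective ℚ-ring using (Expr; Κ; _⊕_; _⊗_; ⊝_) renaming (solve to ring-solve)

infixl 6 _⊖_
_⊖_ : ∀ {n} → Expr ℚ n → Expr ℚ n → Expr ℚ n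
x ⊖ y = x ⊕ (⊝ y)

infix 4 _≐_
_≐_ : ∀ {n} → Expr ℚ n → Expr ℚ n → Expr ℚ n × Expr ℚ n
_≐_ = _,_

nat : ∀ {n} → ℕ → Expr ℚ n
nat k = Κ (ι k)

-- Rational arithmetic: the embedding of ℕ and reciprocals

fromℚᵘ-homo-+ : ∀ p q → fromℚᵘ p + fromℚᵘ q ≡ fromℚᵘ (p +ᵘ q)
fromℚᵘ-homo-+ p q = toℚᵘ-injective (begin
  toℚᵘ (fromℚᵘ p + fromℚᵘ q)             ≈⟨ toℚᵘ-homo-+ (fromℚᵘ p) (fromℚᵘ q) ⟩
  toℚᵘ (fromℚᵘ p) +ᵘ toℚᵘ (fromℚᵘ q)     ≈⟨ ℚᵘₚ.+-cong (toℚᵘ-fromℚᵘ p) (toℚᵘ-fromℚᵘ q) ⟩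
  p +ᵘ q                                 ≈⟨ ℚᵘₚ.≃-sym (toℚᵘ-fromℚᵘ (p +ᵘ q)) ⟩
  toℚᵘ (fromℚᵘ (p +ᵘ q))                 ∎)
  where open ℚᵘₚ.≃-Reasoning

fromℚᵘ-homo-* : ∀ p q → fromℚᵘ p * fromℚᵘ q ≡ fromℚᵘ (p *ᵘ q)
fromℚᵘ-homo-* p q = toℚᵘ-injective (begin
  toℚᵘ (fromℚᵘ p * fromℚᵘ q)             ≈⟨ toℚᵘ-homo-* (fromℚᵘ p) (fromℚᵘ q) ⟩
  toℚᵘ (fromℚᵘ p) *ᵘ toℚᵘ (fromℚᵘ q)     ≈⟨ ℚᵘₚ.*-cong (toℚᵘ-fromℚᵘ p) (toℚᵘ-fromℚᵘ q) ⟩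
  p *ᵘ q                                 ≈⟨ ℚᵘₚ.≃-sym (toℚᵘ-fromℚᵘ (p *ᵘ q)) ⟩
  toℚᵘ (fromℚᵘ (p *ᵘ q))                 ∎)
  where open ℚᵘₚ.≃-Reasoning

ι-+ : ∀ m n → ι (m +ℕ n) ≡ ι m + ι n
ι-+ m n = sym (trans (fromℚᵘ-homo-+ (mkℚᵘ (+ m) 0) (mkℚᵘ (+ n) 0))
  (fromℚᵘ-cong {mkℚᵘ (+ m) 0 +ᵘ mkℚᵘ (+ n) 0} {mkℚᵘ (+ (m +ℕ n)) 0}
    (ℚᵘ.*≡* (cong (ℤ._* + 1) (cong₂ ℤ._+_ (ℤₚ.*-identityʳ (+ m)) (ℤₚ.*-identityʳ (+ n)))))))

ι-* : ∀ m n → ι (m *ℕ n) ≡ ι m * ι n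
ι-* m n = sym (trans (fromℚᵘ-homo-* (mkℚᵘ (+ m) 0) (mkℚᵘ (+ n) 0))
  (fromℚᵘ-cong {mkℚᵘ (+ m) 0 *ᵘ mkℚᵘ (+ n) 0} {mkℚᵘ (+ (m *ℕ n)) 0}
    (ℚᵘ.*≡* (cong (ℤ._* + 1) (sym (ℤₚ.pos-* m n))))))

ι-suc : ∀ n → ι (suc n) ≡ ι n + ι 1
ι-suc n = trans (ι-+ 1 n) (+-comm (ι 1) (ι n))

0≤ι : ∀ n → 0ℚ ≤ ι n
0≤ι n = nonNegative⁻¹ (ι n) {{normalize-nonNeg n 1}}

1/n*n≡1 : ∀ n .{{_ : ℕ.NonZero n}} → (+ 1 / n) * ι n ≡ 1ℚ
1/n*n≡1 (suc k) = trans (fromℚᵘ-homo-* (mkℚᵘ (+ 1) k) (mkℚᵘ (+ suc k) 0))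
  (fromℚᵘ-cong {mkℚᵘ (+ 1) k *ᵘ mkℚᵘ (+ suc k) 0} {mkℚᵘ (+ 1) 0} (ℚᵘ.*≡* (cong +_ (lem k))))
  where
  lem : ∀ k → 1 *ℕ suc k *ℕ 1 ≡ 1 *ℕ (suc k *ℕ 1)
  lem k = ℕₚ.*-assoc 1 (suc k) 1

abstract
  -- Abstract, so that type checking never normalises a symbolic fraction; from here on a reciprocal
  -- is known through its defining product and its sign.
  inv : ℕ → ℚ
  inv k = + 1 / suc k

  inv*suc : ∀ k → inv k * ι (suc k) ≡ 1ℚ
  inv*suc k = 1/n*n≡1 (suc k)

  0≤inv : ∀ k → 0ℚ ≤ inv k
  0≤inv k = nonNegative⁻¹ (inv k) {{normalize-nonNeg 1 (suc k)}}

-- Denominators are at least 1, so the numerator is an explicit Archimedean bound. It supplies the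
-- truncation point beyond which the error is small.
p≤ι∣↥p∣ : ∀ p → p ≤ ι ℤ.∣ ↥ p ∣
p≤ι∣↥p∣ p@record{} = toℚᵘ-cancel-≤ (ℚᵘₚ.≤-respʳ-≃ (ℚᵘₚ.≃-sym (toℚᵘ-fromℚᵘ (mkℚᵘ (+ ℤ.∣ ↥ p ∣) 0)))
  (ℚᵘ.*≤* (ℤₚ.≤-trans (ℤₚ.≤-reflexive (ℤₚ.*-identityʳ (↥ p))) (ℤₚ.≤-trans (i≤+∣i∣ (↥ p))
    (ℤₚ.≤-trans (ℤₚ.≤-reflexive (sym (ℤₚ.*-identityʳ (+ ℤ.∣ ↥ p ∣))))
      (ℤₚ.*-monoˡ-≤-nonNeg (+ ℤ.∣ ↥ p ∣) (ℤ.+≤+ (s≤s z≤n))))))))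
  where
  i≤+∣i∣ : ∀ i → i ℤ.≤ + ℤ.∣ i ∣
  i≤+∣i∣ (+ n) = ℤₚ.≤-refl
  i≤+∣i∣ (ℤ.-[1+ n ]) = ℤ.-≤+

0≤* : ∀ {p q} → 0ℚ ≤ p → 0ℚ ≤ q → 0ℚ ≤ p * q
0≤* {p} {q} 0≤p 0≤q = nonNegative⁻¹ (p * q)
  {{nonNeg*nonNeg⇒nonNeg p {{nonNegative 0≤p}} q {{nonNegative 0≤q}}}}

0≤+ : ∀ {p q} → 0ℚ ≤ p → 0ℚ ≤ q → 0ℚ ≤ p + q
0≤+ {p} {q} 0≤p 0≤q = +-mono-≤ 0≤p 0≤q

*-mono-≤ : ∀ {p q r s} → 0ℚ ≤ r → 0ℚ ≤ q → p ≤ q → r ≤ s → p * r ≤ q * s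
*-mono-≤ {p} {q} {r} {s} 0≤r 0≤q p≤q r≤s = ≤-trans
  (*-monoʳ-≤-nonNeg r {{nonNegative 0≤r}} p≤q) (*-monoˡ-≤-nonNeg q {{nonNegative 0≤q}} r≤s)

≤-by-diff : ∀ {p q} r → 0ℚ ≤ r → q ≡ p + r → p ≤ q
≤-by-diff {p} r 0≤r refl = ≤-trans (≤-reflexive (sym (+-identityʳ p))) (+-monoʳ-≤ p 0≤r)

p≤q⇒0≤q-p : ∀ {p q} → p ≤ q → 0ℚ ≤ q - p
p≤q⇒0≤q-p {p} {q} p≤q = ≤-trans (≤-reflexive (sym (+-inverseʳ p))) (+-monoˡ-≤ (- p) p≤q)

p≤∣p∣ : ∀ p → p ≤ ∣ p ∣
p≤∣p∣ p with ≤-total 0ℚ p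
... | inj₁ 0≤p = ≤-reflexive (sym (0≤p⇒∣p∣≡p 0≤p))
... | inj₂ p≤0 = ≤-trans p≤0 (0≤∣p∣ p)

abstract
  -- ϵ k = 1/(2k+1) and θ k = 1/(2k+2).
  ϵ θ : ℕ → ℚ
  ϵ k = inv (2 *ℕ k)
  θ k = ½ * inv k

  ϵ-inverse : ∀ k → ϵ k * (ι 2 * ι k + ι 1) ≡ 1ℚ
  ϵ-inverse k = trans (cong (ϵ k *_) (sym (trans (ι-suc (2 *ℕ k)) (cong (_+ ι 1) (ι-* 2 k))))) (inv*suc (2 *ℕ k))

  θ-inverse : ∀ k → θ k * (ι 2 * ι k + ι 2) ≡ 1ℚ
  θ-inverse k = trans (lem (inv k) (ι k)) (trans (cong (inv k *_) (sym (ι-suc k))) (inv*suc k))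
    where
    lem : ∀ x m → ½ * x * (ι 2 * m + ι 2) ≡ x * (m + ι 1)
    lem = solve-∀ ℚ-ring

  inv≡2θ : ∀ k → inv k ≡ ι 2 * θ k
  inv≡2θ k = lem (inv k)
    where
    lem : ∀ x → x ≡ ι 2 * (½ * x)
    lem = solve-∀ ℚ-ring

  0≤ϵ : ∀ k → 0ℚ ≤ ϵ k
  0≤ϵ k = 0≤inv (2 *ℕ k)

  0≤θ : ∀ k → 0ℚ ≤ θ k
  0≤θ k = 0≤* (nonNegative⁻¹ ½) (0≤inv k)

ϵ-suc-inverse : ∀ k → ϵ (suc k) * (ι 2 * ι k + ι 3) ≡ 1ℚ
ϵ-suc-inverse k = trans (cong (ϵ (suc k) *_) (sym (trans (cong (λ x → ι 2 * x + ι 1) (ι-suc k)) (lem (ι k))))) (ϵ-inverse (suc k))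
  where
  lem : ∀ x → ι 2 * (x + ι 1) + ι 1 ≡ ι 2 * x + ι 3
  lem = solve-∀ ℚ-ring

-- Creative telescoping for the summand

-- w n i = ∏_{1≤j≤n} (2i+2j) / ∏_{0≤j≤n} (2i+2j+1), and D n i is minus the logarithmic
-- derivative of w n in the variable y = 2i, so T n is -½ d(w²)/dy.
w : ℕ → ℕ → ℚ
w zero    i = ϵ i
w (suc n) i = w n i * (ι 2 * ι (i +ℕ n) + ι 2) * ϵ (suc (i +ℕ n))

D : ℕ → ℕ → ℚ
D zero    i = ϵ i
D (suc n) i = D n i + ϵ (suc (i +ℕ n)) - θ (i +ℕ n)

T : ℕ → ℕ → ℚ
T n i = w n i * w n i * D n i

h : ℚ → ℚ → ℚ
h t y = ι 2 * t * y + (t - ι 1) * (ι 2 * t + ι 1)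

-- At t = 2n+3 these are 8(n+2)³, 4(2n+3)(2n²+6n+5) and 8(n+1)³, i.e. up to a common factor the
-- coefficients of the recurrence for uₙ/16ⁿ.
c₂ c₁ c₀ : ℚ → ℚ
c₂ t = (t + ι 1) * (t + ι 1) * (t + ι 1)
c₁ t = ι 2 * t * (t * t + ι 1)
c₀ t = (t - ι 1) * (t - ι 1) * (t - ι 1)

τ : ℕ → ℚ
τ n = ι 2 * ι n + ι 3

-- H n is -½ d/dy of y² h(t,y) w² / (y+t)², the telescoper of T n.
H : ℕ → ℕ → ℚ
H n i = w n i * w n i * (α * α) * (y * y * h t y * (D n i + α) - y * h t y - t * y * y)
  where
  α = ϵ (suc (i +ℕ n))
  y = ι 2 * ι i
  t = τ n

-- Both products slide by one place: the numerator gains 2(i+n)+2 and loses 2i+2, the denominator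
-- gains 2(i+n)+3 and loses 2i+1. `D-shift` is the logarithmic derivative of this.
w-shift : ∀ n i → w n (suc i) ≡ w n i * (ι 2 * ι (i +ℕ n) + ι 2) * (ι 2 * ι i + ι 1) * ϵ (suc (i +ℕ n)) * θ i
w-shift zero i rewrite ℕₚ.+-identityʳ i = sym (begin
  ϵ i * (ι 2 * ι i + ι 2) * (ι 2 * ι i + ι 1) * ϵ (suc i) * θ i
    ≡⟨ lem (ϵ i) (ι 2 * ι i + ι 2) (ι 2 * ι i + ι 1) (ϵ (suc i)) (θ i) ⟩
  ϵ i * (ι 2 * ι i + ι 1) * (θ i * (ι 2 * ι i + ι 2)) * ϵ (suc i)
    ≡⟨ cong₂ (λ x y → x * y * ϵ (suc i)) (ϵ-inverse i) (θ-inverse i) ⟩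
  1ℚ * 1ℚ * ϵ (suc i)
    ≡⟨ *-identityˡ (ϵ (suc i)) ⟩
  ϵ (suc i) ∎)
  where
  open ≡-Reasoning
  lem : ∀ p q r s t → p * q * r * s * t ≡ p * r * (t * q) * s
  lem = solve-∀ ℚ-ring
w-shift (suc n) i = trans (cong (λ v → v * (ι 2 * ι (suc (i +ℕ n)) + ι 2) * ϵ (suc (suc (i +ℕ n)))) (w-shift n i))
  (trans (lem (w n i) (ι 2 * ι (i +ℕ n) + ι 2) (ι 2 * ι i + ι 1) (ϵ (suc (i +ℕ n))) (θ i) (ι 2 * ι (suc (i +ℕ n)) + ι 2) (ϵ (suc (suc (i +ℕ n)))))
    (cong (λ k → w (suc n) i * (ι 2 * ι k + ι 2) * (ι 2 * ι i + ι 1) * ϵ (suc k) * θ i) (sym (ℕₚ.+-suc i n))))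
  where
  lem : ∀ p q r s t u v → p * q * r * s * t * u * v ≡ p * q * s * u * r * v * t
  lem = solve-∀ ℚ-ring

D-shift : ∀ n i → D n (suc i) ≡ D n i - ϵ i + ϵ (suc (i +ℕ n)) - θ (i +ℕ n) + θ i
D-shift zero i rewrite ℕₚ.+-identityʳ i = lem (ϵ i) (ϵ (suc i)) (θ i)
  where
  lem : ∀ p q r → q ≡ p - p + q - r + r
  lem = solve-∀ ℚ-ring
D-shift (suc n) i = trans (cong (λ d → d + ϵ (suc (suc (i +ℕ n))) - θ (suc (i +ℕ n))) (D-shift n i))
  (trans (lem (D n i) (ϵ i) (ϵ (suc (i +ℕ n))) (θ (i +ℕ n)) (θ i) (ϵ (suc (suc (i +ℕ n)))) (θ (suc (i +ℕ n))))
    (cong (λ k → D (suc n) i - ϵ i + ϵ (suc k) - θ k + θ i) (sym (ℕₚ.+-suc i n))))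
  where
  lem : ∀ p q r s t u v → p - q + r - s + t + u - v ≡ p + r - s - q + u - v + t
  lem = solve-∀ ℚ-ring

-- Creative telescoping for w², where t = 2n+3, y = 2i and x = y + t.
certificate : ∀ t x y → y ≡ x - t → let a = x - ι 1; b = x + ι 1; B = x + ι 2; e = y + ι 1 in
  c₂ t * (a * a * b * b) - c₁ t * (a * a * B * B) + c₀ t * (x * x * B * B)
  ≡ y * y * h t y * B * B - h t (y + ι 2) * a * a * e * e
certificate t x _ refl = lem t x
  where
  lem = ring-solve 2 (λ t x →
    (t ⊕ nat 1) ⊗ (t ⊕ nat 1) ⊗ (t ⊕ nat 1) ⊗ ((x ⊖ nat 1) ⊗ (x ⊖ nat 1) ⊗ (x ⊕ nat 1) ⊗ (x ⊕ nat 1))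
    ⊖ nat 2 ⊗ t ⊗ (t ⊗ t ⊕ nat 1) ⊗ ((x ⊖ nat 1) ⊗ (x ⊖ nat 1) ⊗ (x ⊕ nat 2) ⊗ (x ⊕ nat 2))
    ⊕ (t ⊖ nat 1) ⊗ (t ⊖ nat 1) ⊗ (t ⊖ nat 1) ⊗ (x ⊗ x ⊗ (x ⊕ nat 2) ⊗ (x ⊕ nat 2))
    ≐ (x ⊖ t) ⊗ (x ⊖ t) ⊗ (nat 2 ⊗ t ⊗ (x ⊖ t) ⊕ (t ⊖ nat 1) ⊗ (nat 2 ⊗ t ⊕ nat 1)) ⊗ (x ⊕ nat 2) ⊗ (x ⊕ nat 2)
    ⊖ (nat 2 ⊗ t ⊗ (x ⊖ t ⊕ nat 2) ⊕ (t ⊖ nat 1) ⊗ (nat 2 ⊗ t ⊕ nat 1)) ⊗ (x ⊖ nat 1) ⊗ (x ⊖ nat 1) ⊗ (x ⊖ t ⊕ nat 1) ⊗ (x ⊖ t ⊕ nat 1)) refl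

-- Half the derivative of the previous identity in x at fixed t.
certificate′ : ∀ t x y → y ≡ x - t → let a = x - ι 1; b = x + ι 1; B = x + ι 2; e = y + ι 1 in
  c₂ t * (a * b * b + a * a * b) - c₁ t * (a * a * B + a * B * B) + c₀ t * (x * B * B + x * x * B)
  ≡ y * h t y * B * B + y * y * h t y * B + t * y * y * B * B - t * a * a * e * e - h t (y + ι 2) * (a * a * e + a * e * e)
certificate′ t x _ refl = lem t x
  where
  lem = ring-solve 2 (λ t x →
    (t ⊕ nat 1) ⊗ (t ⊕ nat 1) ⊗ (t ⊕ nat 1) ⊗ ((x ⊖ nat 1) ⊗ (x ⊕ nat 1) ⊗ (x ⊕ nat 1) ⊕ (x ⊖ nat 1) ⊗ (x ⊖ nat 1) ⊗ (x ⊕ nat 1))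
    ⊖ nat 2 ⊗ t ⊗ (t ⊗ t ⊕ nat 1) ⊗ ((x ⊖ nat 1) ⊗ (x ⊖ nat 1) ⊗ (x ⊕ nat 2) ⊕ (x ⊖ nat 1) ⊗ (x ⊕ nat 2) ⊗ (x ⊕ nat 2))
    ⊕ (t ⊖ nat 1) ⊗ (t ⊖ nat 1) ⊗ (t ⊖ nat 1) ⊗ (x ⊗ (x ⊕ nat 2) ⊗ (x ⊕ nat 2) ⊕ x ⊗ x ⊗ (x ⊕ nat 2))
    ≐ (x ⊖ t) ⊗ (nat 2 ⊗ t ⊗ (x ⊖ t) ⊕ (t ⊖ nat 1) ⊗ (nat 2 ⊗ t ⊕ nat 1)) ⊗ (x ⊕ nat 2) ⊗ (x ⊕ nat 2)
    ⊕ (x ⊖ t) ⊗ (x ⊖ t) ⊗ (nat 2 ⊗ t ⊗ (x ⊖ t) ⊕ (t ⊖ nat 1) ⊗ (nat 2 ⊗ t ⊕ nat 1)) ⊗ (x ⊕ nat 2)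
    ⊕ t ⊗ (x ⊖ t) ⊗ (x ⊖ t) ⊗ (x ⊕ nat 2) ⊗ (x ⊕ nat 2)
    ⊖ t ⊗ (x ⊖ nat 1) ⊗ (x ⊖ nat 1) ⊗ (x ⊖ t ⊕ nat 1) ⊗ (x ⊖ t ⊕ nat 1)
    ⊖ (nat 2 ⊗ t ⊗ (x ⊖ t ⊕ nat 2) ⊕ (t ⊖ nat 1) ⊗ (nat 2 ⊗ t ⊕ nat 1)) ⊗ ((x ⊖ nat 1) ⊗ (x ⊖ nat 1) ⊗ (x ⊖ t ⊕ nat 1) ⊕ (x ⊖ nat 1) ⊗ (x ⊖ t ⊕ nat 1) ⊗ (x ⊖ t ⊕ nat 1))) refl

p-q≡0⇒p≡q : ∀ p q → p - q ≡ 0ℚ → p ≡ q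
p-q≡0⇒p≡q p q eq = trans (lem p q) (trans (cong (_+ q) eq) (+-identityˡ q))
  where
  lem : ∀ p q → p ≡ p - q + q
  lem = solve-∀ ℚ-ring

-- Differentiating w² multiplies by D, up to the shifts α and β coming from the factors A and B:
-- the coefficient of D + α + β is eq, what remains is eq′.  In F and K, the arguments o and q
-- stand for α A and β B.
module _ (p₂ p₁ p₀ a b A B e y g g⁺ k P D α β : ℚ)
  (αA≡1 : α * A ≡ 1ℚ) (βB≡1 : β * B ≡ 1ℚ)
  (eq : p₂ * (a * a * b * b) - p₁ * (a * a * B * B) + p₀ * (A * A * B * B)
      ≡ y * y * g * B * B - g⁺ * a * a * e * e)
  (eq′ : p₂ * (a * b * b + a * a * b) - p₁ * (a * a * B + a * B * B) + p₀ * (A * B * B + A * A * B)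
       ≡ y * g * B * B + y * y * g * B + k * y * y * B * B - k * a * a * e * e - g⁺ * (a * a * e + a * e * e))
  where

  private
    F K : ℚ → ℚ → ℚ
    F o q = p₂ * (P * (α * α) * (β * β) * (a * a * b * b * (D + α + β) - a * b * b - a * a * b))
        - p₁ * ((P * (α * α) * (a * a * (D + α) - a)) * q * q)
        + p₀ * (P * D) * o * o * q * q
        - ((P * (α * α) * (y * y * g * (D + α) - y * g - k * y * y)) * q * q
        - (P * (α * α) * (β * β) * (g⁺ * (a * a * e * e * (D + α + β) - a * a * e - a * e * e) - k * a * a * e * e)))
    K o q = P * (α * α) * (β * β) * ((D + α + β) * ((p₂ * (a * a * b * b) - p₁ * (a * a * B * B) + p₀ * (A * A * B * B))
        - (y * y * g * B * B - g⁺ * a * a * e * e))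
        - ((p₂ * (a * b * b + a * a * b) - p₁ * (a * a * B * q + a * B * B) + p₀ * (A * B * B * o + A * A * B * q))
        - (y * g * B * B + y * y * g * B * q + k * y * y * B * B - k * a * a * e * e - g⁺ * (a * a * e + a * e * e))))

    F₁₁ = ring-solve 16 (λ p₂ p₁ p₀ a b A B e y g g⁺ k P D α β →
      (p₂ ⊗ (P ⊗ (α ⊗ α) ⊗ (β ⊗ β) ⊗ (a ⊗ a ⊗ b ⊗ b ⊗ (D ⊕ α ⊕ β) ⊖ a ⊗ b ⊗ b ⊖ a ⊗ a ⊗ b))
        ⊖ p₁ ⊗ (P ⊗ (α ⊗ α) ⊗ (a ⊗ a ⊗ (D ⊕ α) ⊖ a))
        ⊕ p₀ ⊗ (P ⊗ D))
      ⊖ ((P ⊗ (α ⊗ α) ⊗ (y ⊗ y ⊗ g ⊗ (D ⊕ α) ⊖ y ⊗ g ⊖ k ⊗ y ⊗ y))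
        ⊖ (P ⊗ (α ⊗ α) ⊗ (β ⊗ β) ⊗ (g⁺ ⊗ (a ⊗ a ⊗ e ⊗ e ⊗ (D ⊕ α ⊕ β) ⊖ a ⊗ a ⊗ e ⊖ a ⊗ e ⊗ e) ⊖ k ⊗ a ⊗ a ⊗ e ⊗ e)))
      ≐ p₂ ⊗ (P ⊗ (α ⊗ α) ⊗ (β ⊗ β) ⊗ (a ⊗ a ⊗ b ⊗ b ⊗ (D ⊕ α ⊕ β) ⊖ a ⊗ b ⊗ b ⊖ a ⊗ a ⊗ b))
        ⊖ p₁ ⊗ ((P ⊗ (α ⊗ α) ⊗ (a ⊗ a ⊗ (D ⊕ α) ⊖ a)) ⊗ Κ 1ℚ ⊗ Κ 1ℚ)
        ⊕ p₀ ⊗ (P ⊗ D) ⊗ Κ 1ℚ ⊗ Κ 1ℚ ⊗ Κ 1ℚ ⊗ Κ 1ℚ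
        ⊖ ((P ⊗ (α ⊗ α) ⊗ (y ⊗ y ⊗ g ⊗ (D ⊕ α) ⊖ y ⊗ g ⊖ k ⊗ y ⊗ y)) ⊗ Κ 1ℚ ⊗ Κ 1ℚ
        ⊖ (P ⊗ (α ⊗ α) ⊗ (β ⊗ β) ⊗ (g⁺ ⊗ (a ⊗ a ⊗ e ⊗ e ⊗ (D ⊕ α ⊕ β) ⊖ a ⊗ a ⊗ e ⊖ a ⊗ e ⊗ e) ⊖ k ⊗ a ⊗ a ⊗ e ⊗ e)))) refl

    F≡K = ring-solve 16 (λ p₂ p₁ p₀ a b A B e y g g⁺ k P D α β →
      p₂ ⊗ (P ⊗ (α ⊗ α) ⊗ (β ⊗ β) ⊗ (a ⊗ a ⊗ b ⊗ b ⊗ (D ⊕ α ⊕ β) ⊖ a ⊗ b ⊗ b ⊖ a ⊗ a ⊗ b))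
        ⊖ p₁ ⊗ ((P ⊗ (α ⊗ α) ⊗ (a ⊗ a ⊗ (D ⊕ α) ⊖ a)) ⊗ (β ⊗ B) ⊗ (β ⊗ B))
        ⊕ p₀ ⊗ (P ⊗ D) ⊗ (α ⊗ A) ⊗ (α ⊗ A) ⊗ (β ⊗ B) ⊗ (β ⊗ B)
        ⊖ ((P ⊗ (α ⊗ α) ⊗ (y ⊗ y ⊗ g ⊗ (D ⊕ α) ⊖ y ⊗ g ⊖ k ⊗ y ⊗ y)) ⊗ (β ⊗ B) ⊗ (β ⊗ B)
        ⊖ (P ⊗ (α ⊗ α) ⊗ (β ⊗ β) ⊗ (g⁺ ⊗ (a ⊗ a ⊗ e ⊗ e ⊗ (D ⊕ α ⊕ β) ⊖ a ⊗ a ⊗ e ⊖ a ⊗ e ⊗ e) ⊖ k ⊗ a ⊗ a ⊗ e ⊗ e)))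
      ≐ P ⊗ (α ⊗ α) ⊗ (β ⊗ β) ⊗ ((D ⊕ α ⊕ β) ⊗ ((p₂ ⊗ (a ⊗ a ⊗ b ⊗ b) ⊖ p₁ ⊗ (a ⊗ a ⊗ B ⊗ B) ⊕ p₀ ⊗ (A ⊗ A ⊗ B ⊗ B))
        ⊖ (y ⊗ y ⊗ g ⊗ B ⊗ B ⊖ g⁺ ⊗ a ⊗ a ⊗ e ⊗ e))
        ⊖ ((p₂ ⊗ (a ⊗ b ⊗ b ⊕ a ⊗ a ⊗ b) ⊖ p₁ ⊗ (a ⊗ a ⊗ B ⊗ (β ⊗ B) ⊕ a ⊗ B ⊗ B) ⊕ p₀ ⊗ (A ⊗ B ⊗ B ⊗ (α ⊗ A) ⊕ A ⊗ A ⊗ B ⊗ (β ⊗ B)))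
        ⊖ (y ⊗ g ⊗ B ⊗ B ⊕ y ⊗ y ⊗ g ⊗ B ⊗ (β ⊗ B) ⊕ k ⊗ y ⊗ y ⊗ B ⊗ B ⊖ k ⊗ a ⊗ a ⊗ e ⊗ e ⊖ g⁺ ⊗ (a ⊗ a ⊗ e ⊕ a ⊗ e ⊗ e))))) refl

    K₁₁ : ∀ P D α β X Y X′ Y′ → X ≡ Y → X′ ≡ Y′ →
      P * (α * α) * (β * β) * ((D + α + β) * (X - Y) - (X′ - Y′)) ≡ 0ℚ
    K₁₁ P D α β X _ X′ _ refl refl = lem P D α β X X′
      where
      lem : ∀ P D α β X X′ → P * (α * α) * (β * β) * ((D + α + β) * (X - X) - (X′ - X′)) ≡ 0ℚ
      lem = solve-∀ ℚ-ring

    unit = ring-solve 7 (λ p₂ p₁ p₀ a b A B →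
      p₂ ⊗ (a ⊗ b ⊗ b ⊕ a ⊗ a ⊗ b) ⊖ p₁ ⊗ (a ⊗ a ⊗ B ⊕ a ⊗ B ⊗ B) ⊕ p₀ ⊗ (A ⊗ B ⊗ B ⊕ A ⊗ A ⊗ B) ≐ p₂ ⊗ (a ⊗ b ⊗ b ⊕ a ⊗ a ⊗ b) ⊖ p₁ ⊗ (a ⊗ a ⊗ B ⊗ Κ 1ℚ ⊕ a ⊗ B ⊗ B) ⊕ p₀ ⊗ (A ⊗ B ⊗ B ⊗ Κ 1ℚ ⊕ A ⊗ A ⊗ B ⊗ Κ 1ℚ)) refl

    unit′ = ring-solve 7 (λ a B e y g g⁺ k →
      y ⊗ g ⊗ B ⊗ B ⊕ y ⊗ y ⊗ g ⊗ B ⊕ k ⊗ y ⊗ y ⊗ B ⊗ B ⊖ k ⊗ a ⊗ a ⊗ e ⊗ e ⊖ g⁺ ⊗ (a ⊗ a ⊗ e ⊕ a ⊗ e ⊗ e) ≐ y ⊗ g ⊗ B ⊗ B ⊕ y ⊗ y ⊗ g ⊗ B ⊗ Κ 1ℚ ⊕ k ⊗ y ⊗ y ⊗ B ⊗ B ⊖ k ⊗ a ⊗ a ⊗ e ⊗ e ⊖ g⁺ ⊗ (a ⊗ a ⊗ e ⊕ a ⊗ e ⊗ e)) refl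

  telescoping-algebra :
    p₂ * (P * (α * α) * (β * β) * (a * a * b * b * (D + α + β) - a * b * b - a * a * b))
        - p₁ * (P * (α * α) * (a * a * (D + α) - a))
        + p₀ * (P * D)
    ≡ (P * (α * α) * (y * y * g * (D + α) - y * g - k * y * y))
        - (P * (α * α) * (β * β) * (g⁺ * (a * a * e * e * (D + α + β) - a * a * e - a * e * e) - k * a * a * e * e))
  telescoping-algebra = p-q≡0⇒p≡q _ _ (begin
    _                     ≡⟨ F₁₁ p₂ p₁ p₀ a b A B e y g g⁺ k P D α β ⟩
    F 1ℚ 1ℚ               ≡⟨ cong₂ F αA≡1 βB≡1 ⟨
    F (α * A) (β * B)     ≡⟨ F≡K p₂ p₁ p₀ a b A B e y g g⁺ k P D α β ⟩
    K (α * A) (β * B)     ≡⟨ cong₂ K αA≡1 βB≡1 ⟩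
    K 1ℚ 1ℚ               ≡⟨ K₁₁ P D α β _ _ _ _ eq (trans (sym (unit p₂ p₁ p₀ a b A B)) (trans eq′ (unit′ a B e y g g⁺ k))) ⟩
    0ℚ                    ∎)
    where open ≡-Reasoning

-- The `θ` introduced by `D (suc n)` is the reciprocal of a, so it cancels against one factor of a².
-- Thus only powers of α remain next to the data of `w n`, the shape that `telescoping-algebra`
-- expects; a is a variable so that it can be supplied in the coordinate x = y + t.
T-suc : ∀ n i a → ι 2 * ι (i +ℕ n) + ι 2 ≡ a → let α = ϵ (suc (i +ℕ n)) in
  T (suc n) i ≡ w n i * w n i * (α * α) * (a * a * (D n i + α) - a)
T-suc n i a refl = trans (lem (w n i) (D n i) a (ϵ (suc (i +ℕ n))) (θ (i +ℕ n)))
  (trans (cong (λ o → w n i * w n i * (α * α) * (a * a * (D n i + α) - a * o)) (θ-inverse (i +ℕ n)))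
    (cong (λ x → w n i * w n i * (α * α) * (a * a * (D n i + α) - x)) (*-identityʳ a)))
  where
  α = ϵ (suc (i +ℕ n))
  lem : ∀ w D a α κ → w * a * α * (w * a * α) * (D + α - κ) ≡ w * w * (α * α) * (a * a * (D + α) - a * (κ * a))
  lem = solve-∀ ℚ-ring

T-suc-suc : ∀ n i a b → ι 2 * ι (i +ℕ n) + ι 2 ≡ a → ι 2 * ι (suc (i +ℕ n)) + ι 2 ≡ b →
  let α = ϵ (suc (i +ℕ n)); β = ϵ (suc (suc (i +ℕ n))) in
  T (suc (suc n)) i ≡ w n i * w n i * (α * α) * (β * β) * (a * a * b * b * (D n i + α + β) - a * b * b - a * a * b)
T-suc-suc n i a b refl refl = trans
  (cong (λ k → let v = w n i * a * α * (ι 2 * ι k + ι 2) * ϵ (suc k) in v * v * (D n i + α - θ (i +ℕ n) + ϵ (suc k) - θ k)) (ℕₚ.+-suc i n))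
  (trans (lem (w n i) (D n i) a α (θ (i +ℕ n)) b β (θ (suc (i +ℕ n))))
    (trans (cong₂ (λ o q → w n i * w n i * (α * α) * (β * β) * (a * a * b * b * (D n i + α + β) - a * b * b * o - a * a * b * q))
             (θ-inverse (i +ℕ n)) (θ-inverse (suc (i +ℕ n))))
      (cong₂ (λ x y → w n i * w n i * (α * α) * (β * β) * (a * a * b * b * (D n i + α + β) - x - y))
        (*-identityʳ (a * b * b)) (*-identityʳ (a * a * b)))))
  where
  α = ϵ (suc (i +ℕ n))
  β = ϵ (suc (suc (i +ℕ n)))
  lem = ring-solve 8 (λ w D a α κ b β μ → w ⊗ a ⊗ α ⊗ b ⊗ β ⊗ (w ⊗ a ⊗ α ⊗ b ⊗ β) ⊗ (D ⊕ α ⊖ κ ⊕ β ⊖ μ)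
    ≐ w ⊗ w ⊗ (α ⊗ α) ⊗ (β ⊗ β) ⊗ (a ⊗ a ⊗ b ⊗ b ⊗ (D ⊕ α ⊕ β) ⊖ a ⊗ b ⊗ b ⊗ (κ ⊗ a) ⊖ a ⊗ a ⊗ b ⊗ (μ ⊗ b))) refl

H-shift : ∀ n i a Y → ι 2 * ι (i +ℕ n) + ι 2 ≡ a → ι 2 * ι (suc i) ≡ Y →
  let α = ϵ (suc (i +ℕ n)); β = ϵ (suc (suc (i +ℕ n))); e = ι 2 * ι i + ι 1; t = τ n in
  H n (suc i) ≡ w n i * w n i * (α * α) * (β * β)
    * (h t Y * (a * a * e * e * (D n i + α + β) - a * a * e - a * e * e) - t * a * a * e * e)
H-shift n i a Y refl refl = begin
  H n (suc i)
    ≡⟨ cong₂ (λ v d → v * v * (β * β) * (Y * Y * h t Y * (d + β) - Y * h t Y - t * Y * Y)) (w-shift n i) (D-shift n i) ⟩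
  _ ≡⟨ lem (w n i) (D n i) a e Y α β (θ i) (ϵ i) (θ (i +ℕ n)) (h t Y) t ⟩
  Φ (θ i * Y) (ϵ i * e) (θ (i +ℕ n) * a)
    ≡⟨ cong (λ o → Φ o (ϵ i * e) (θ (i +ℕ n) * a)) (trans (cong (θ i *_) Y≡) (θ-inverse i)) ⟩
  Φ 1ℚ (ϵ i * e) (θ (i +ℕ n) * a) ≡⟨ cong₂ (Φ 1ℚ) (ϵ-inverse i) (θ-inverse (i +ℕ n)) ⟩
  Φ 1ℚ 1ℚ 1ℚ ≡⟨ lem₁ (w n i) (D n i) a e Y α β (θ i) (h t Y) t ⟩
  _ ∎
  where
  open ≡-Reasoning
  α = ϵ (suc (i +ℕ n))
  β = ϵ (suc (suc (i +ℕ n)))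
  e = ι 2 * ι i + ι 1
  t = τ n
  Y≡ : Y ≡ ι 2 * ι i + ι 2
  Y≡ = trans (cong (ι 2 *_) (ι-suc i)) (*-distribˡ-+ (ι 2) (ι i) (ι 1))
  -- The arguments stand for `θ i * Y`, `ϵ i * e` and `θ (i +ℕ n) * a`. The part with `o * o - o`
  -- joins the `θ i` of `D-shift` to the term y h of `H`; they cancel at o = 1.
  Φ : ℚ → ℚ → ℚ → ℚ
  Φ o q r = w n i * w n i * (α * α) * (β * β)
    * (h t Y * (a * a * e * e * (D n i + α + β) * o * o - a * a * e * q * o * o - a * e * e * r * o * o + a * a * e * e * θ i * (o * o - o)) - t * a * a * e * e * o * o)
  lem = ring-solve 12 (λ w D a e Y α β γ ε κ g k →
    w ⊗ a ⊗ e ⊗ α ⊗ γ ⊗ (w ⊗ a ⊗ e ⊗ α ⊗ γ) ⊗ (β ⊗ β) ⊗ (Y ⊗ Y ⊗ g ⊗ (D ⊖ ε ⊕ α ⊖ κ ⊕ γ ⊕ β) ⊖ Y ⊗ g ⊖ k ⊗ Y ⊗ Y)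
    ≐ w ⊗ w ⊗ (α ⊗ α) ⊗ (β ⊗ β) ⊗ (g ⊗ (a ⊗ a ⊗ e ⊗ e ⊗ (D ⊕ α ⊕ β) ⊗ (γ ⊗ Y) ⊗ (γ ⊗ Y) ⊖ a ⊗ a ⊗ e ⊗ (ε ⊗ e) ⊗ (γ ⊗ Y) ⊗ (γ ⊗ Y) ⊖ a ⊗ e ⊗ e ⊗ (κ ⊗ a) ⊗ (γ ⊗ Y) ⊗ (γ ⊗ Y) ⊕ a ⊗ a ⊗ e ⊗ e ⊗ γ ⊗ ((γ ⊗ Y) ⊗ (γ ⊗ Y) ⊖ (γ ⊗ Y))) ⊖ k ⊗ a ⊗ a ⊗ e ⊗ e ⊗ (γ ⊗ Y) ⊗ (γ ⊗ Y))) refl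
  lem₁ = ring-solve 10 (λ w D a e Y α β γ g k →
    w ⊗ w ⊗ (α ⊗ α) ⊗ (β ⊗ β) ⊗ (g ⊗ (a ⊗ a ⊗ e ⊗ e ⊗ (D ⊕ α ⊕ β) ⊗ Κ 1ℚ ⊗ Κ 1ℚ ⊖ a ⊗ a ⊗ e ⊗ Κ 1ℚ ⊗ Κ 1ℚ ⊗ Κ 1ℚ ⊖ a ⊗ e ⊗ e ⊗ Κ 1ℚ ⊗ Κ 1ℚ ⊗ Κ 1ℚ ⊕ a ⊗ a ⊗ e ⊗ e ⊗ γ ⊗ (Κ 1ℚ ⊗ Κ 1ℚ ⊖ Κ 1ℚ)) ⊖ k ⊗ a ⊗ a ⊗ e ⊗ e ⊗ Κ 1ℚ ⊗ Κ 1ℚ)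
    ≐ w ⊗ w ⊗ (α ⊗ α) ⊗ (β ⊗ β) ⊗ (g ⊗ (a ⊗ a ⊗ e ⊗ e ⊗ (D ⊕ α ⊕ β) ⊖ a ⊗ a ⊗ e ⊖ a ⊗ e ⊗ e) ⊖ k ⊗ a ⊗ a ⊗ e ⊗ e)) refl

-- In the coordinate x = y + t, raising n once multiplies w by (x-1)/x and raising it again by
-- (x+1)/(x+2), which are the a/A and b/B of `telescoping-algebra`.
T-recurrence : ∀ n i → let t = τ n in
  c₂ t * T (suc (suc n)) i - c₁ t * T (suc n) i + c₀ t * T n i ≡ H n i - H n (suc i)
T-recurrence n i = begin
  _ ≡⟨ cong₂ (λ p q → c₂ t * p - c₁ t * q + c₀ t * T n i)
         (T-suc-suc n i (x - ι 1) (x + ι 1) (lem₁ n i) (lem₂ n i)) (T-suc n i (x - ι 1) (lem₁ n i)) ⟩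
  _ ≡⟨ telescoping-algebra (c₂ t) (c₁ t) (c₀ t) (x - ι 1) (x + ι 1) x (x + ι 2) (y + ι 1) y (h t y) (h t (y + ι 2)) t
         (w n i * w n i) (D n i) α β αx≡1 βB≡1 (certificate t x y (y≡ y t)) (certificate′ t x y (y≡ y t)) ⟩
  _ ≡⟨ cong (λ p → H n i - p) (H-shift n i (x - ι 1) (y + ι 2) (lem₁ n i) Y≡) ⟨
  H n i - H n (suc i) ∎
  where
  open ≡-Reasoning
  t = τ n
  y = ι 2 * ι i
  x = y + t
  α = ϵ (suc (i +ℕ n))
  β = ϵ (suc (suc (i +ℕ n)))
  y≡ : ∀ y t → y ≡ y + t - t
  y≡ = solve-∀ ℚ-ring
  Y≡ : ι 2 * ι (suc i) ≡ y + ι 2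
  Y≡ = trans (cong (ι 2 *_) (ι-suc i)) (*-distribˡ-+ (ι 2) (ι i) (ι 1))
  lem₁ : ∀ n i → ι 2 * ι (i +ℕ n) + ι 2 ≡ ι 2 * ι i + (ι 2 * ι n + ι 3) - ι 1
  lem₁ n i = trans (cong (λ s → ι 2 * s + ι 2) (ι-+ i n)) (lem (ι i) (ι n))
    where
    lem : ∀ x m → ι 2 * (x + m) + ι 2 ≡ ι 2 * x + (ι 2 * m + ι 3) - ι 1
    lem = solve-∀ ℚ-ring
  lem₂ : ∀ n i → ι 2 * ι (suc (i +ℕ n)) + ι 2 ≡ ι 2 * ι i + (ι 2 * ι n + ι 3) + ι 1
  lem₂ n i = trans (cong (λ s → ι 2 * s + ι 2) (trans (ι-suc (i +ℕ n)) (cong (_+ ι 1) (ι-+ i n)))) (lem (ι i) (ι n))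
    where
    lem : ∀ x m → ι 2 * (x + m + ι 1) + ι 2 ≡ ι 2 * x + (ι 2 * m + ι 3) + ι 1
    lem = solve-∀ ℚ-ring
  αx≡1 : α * x ≡ 1ℚ
  αx≡1 = trans (cong (α *_) (sym (trans (cong (λ s → ι 2 * s + ι 3) (ι-+ i n)) (lem (ι i) (ι n))))) (ϵ-suc-inverse (i +ℕ n))
    where
    lem : ∀ x m → ι 2 * (x + m) + ι 3 ≡ ι 2 * x + (ι 2 * m + ι 3)
    lem = solve-∀ ℚ-ring
  βB≡1 : β * (x + ι 2) ≡ 1ℚ
  βB≡1 = trans (cong (β *_) (sym (trans (cong (λ s → ι 2 * s + ι 3) (trans (ι-suc (i +ℕ n)) (cong (_+ ι 1) (ι-+ i n)))) (lem (ι i) (ι n)))))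
      (ϵ-suc-inverse (suc (i +ℕ n)))
    where
    lem : ∀ x m → ι 2 * (x + m + ι 1) + ι 3 ≡ ι 2 * x + (ι 2 * m + ι 3) + ι 2
    lem = solve-∀ ℚ-ring

-- Estimates for the terms, their sums and the telescoper

sum : (ℕ → ℚ) → ℕ → ℚ
sum f zero    = 0ℚ
sum f (suc M) = sum f M + f M

reciprocal-diff : ∀ x x′ d d′ → x * d ≡ 1ℚ → x′ * d′ ≡ 1ℚ → x ≡ x′ + x * x′ * (d′ - d)
reciprocal-diff x x′ d d′ eq eq′ = begin
  x                                   ≡⟨ *-identityʳ x ⟨
  x * 1ℚ                              ≡⟨ cong (x *_) eq′ ⟨
  x * (x′ * d′)                       ≡⟨ lem x x′ d d′ ⟩
  x′ * (x * d) + x * x′ * (d′ - d)    ≡⟨ cong (λ o → x′ * o + x * x′ * (d′ - d)) eq ⟩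
  x′ * 1ℚ + x * x′ * (d′ - d)         ≡⟨ cong (_+ x * x′ * (d′ - d)) (*-identityʳ x′) ⟩
  x′ + x * x′ * (d′ - d)              ∎
  where
  open ≡-Reasoning
  lem : ∀ x x′ d d′ → x * (x′ * d′) ≡ x′ * (x * d) + x * x′ * (d′ - d)
  lem = solve-∀ ℚ-ring

ϵ≡θ+ : ∀ k → ϵ k ≡ θ k + ϵ k * θ k
ϵ≡θ+ k = trans (reciprocal-diff (ϵ k) (θ k) _ _ (ϵ-inverse k) (θ-inverse k)) (lem (ϵ k) (θ k) (ι k))
  where
  lem : ∀ x x′ m → x′ + x * x′ * (ι 2 * m + ι 2 - (ι 2 * m + ι 1)) ≡ x′ + x * x′
  lem = solve-∀ ℚ-ring

θ≡ϵ-suc+ : ∀ k → θ k ≡ ϵ (suc k) + θ k * ϵ (suc k)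
θ≡ϵ-suc+ k = trans (reciprocal-diff (θ k) (ϵ (suc k)) _ _ (θ-inverse k) (ϵ-suc-inverse k)) (lem (θ k) (ϵ (suc k)) (ι k))
  where
  lem : ∀ x x′ m → x′ + x * x′ * (ι 2 * m + ι 3 - (ι 2 * m + ι 2)) ≡ x′ + x * x′
  lem = solve-∀ ℚ-ring

ϵ≡ϵ-suc+ : ∀ k → ϵ k ≡ ϵ (suc k) + ι 2 * (ϵ k * ϵ (suc k))
ϵ≡ϵ-suc+ k = trans (reciprocal-diff (ϵ k) (ϵ (suc k)) _ _ (ϵ-inverse k) (ϵ-suc-inverse k)) (lem (ϵ k) (ϵ (suc k)) (ι k))
  where
  lem : ∀ x x′ m → x′ + x * x′ * (ι 2 * m + ι 3 - (ι 2 * m + ι 1)) ≡ x′ + ι 2 * (x * x′)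
  lem = solve-∀ ℚ-ring

θ≤ϵ : ∀ k → θ k ≤ ϵ k
θ≤ϵ k = ≤-by-diff _ (0≤* (0≤ϵ k) (0≤θ k)) (ϵ≡θ+ k)

ϵ-suc≤θ : ∀ k → ϵ (suc k) ≤ θ k
ϵ-suc≤θ k = ≤-by-diff _ (0≤* (0≤θ k) (0≤ϵ (suc k))) (θ≡ϵ-suc+ k)

0≤2k+c : ∀ k c → 0ℚ ≤ ι 2 * ι k + ι c
0≤2k+c k c = 0≤+ (0≤* (0≤ι 2) (0≤ι k)) (0≤ι c)

ϵ≤1 : ∀ k → ϵ k ≤ 1ℚ
ϵ≤1 k = ≤-by-diff (ϵ k * (ι 2 * ι k)) (0≤* (0≤ϵ k) (0≤* (0≤ι 2) (0≤ι k)))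
  (trans (sym (ϵ-inverse k)) (lem (ϵ k) (ι k)))
  where
  lem : ∀ x m → x * (ι 2 * m + ι 1) ≡ x + x * (ι 2 * m)
  lem = solve-∀ ℚ-ring

D≤ϵ : ∀ n i → D n i ≤ ϵ i
D≤ϵ zero    i = ≤-refl
D≤ϵ (suc n) i = ≤-trans
  (≤-by-diff (θ (i +ℕ n) - ϵ (suc (i +ℕ n))) (p≤q⇒0≤q-p (ϵ-suc≤θ (i +ℕ n))) (lem (D n i) (ϵ (suc (i +ℕ n))) (θ (i +ℕ n))))
  (D≤ϵ n i)
  where
  lem : ∀ d x y → d ≡ d + x - y + (y - x)
  lem = solve-∀ ℚ-ring

-- Stronger than positivity: the next step of the alternating sum subtracts exactly this `θ`, so the
-- induction needs it as a reserve.
θ≤D : ∀ n i → θ (i +ℕ n) ≤ D n i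
θ≤D zero    i rewrite ℕₚ.+-identityʳ i = θ≤ϵ i
θ≤D (suc n) i rewrite ℕₚ.+-suc i n = ≤-trans (θ≤ϵ (suc (i +ℕ n)))
  (≤-by-diff (D n i - θ (i +ℕ n)) (p≤q⇒0≤q-p (θ≤D n i)) (lem (D n i) (ϵ (suc (i +ℕ n))) (θ (i +ℕ n))))
  where
  lem : ∀ d x y → d + x - y ≡ x + (d - y)
  lem = solve-∀ ℚ-ring

0≤D : ∀ n i → 0ℚ ≤ D n i
0≤D n i = ≤-trans (0≤θ (i +ℕ n)) (θ≤D n i)

0≤w : ∀ n i → 0ℚ ≤ w n i
0≤w zero    i = 0≤ϵ i
0≤w (suc n) i = 0≤* (0≤* (0≤w n i) (0≤2k+c (i +ℕ n) 2)) (0≤ϵ (suc (i +ℕ n)))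

0≤T : ∀ n i → 0ℚ ≤ T n i
0≤T n i = 0≤* (0≤* (0≤w n i) (0≤w n i)) (0≤D n i)

-- A Wallis-type monotonicity: with k = i + n, one step in n multiplies the left side by
-- (2k+2)(2k+4)/(2k+3)² < 1, starting from (2i+2)/(2i+1) ≤ 2.
w²-bound : ∀ n i → w n i * w n i * ((ι 2 * ι i + ι 1) * (ι 2 * ι (i +ℕ n) + ι 2)) ≤ ι 2
w²-bound zero i rewrite ℕₚ.+-identityʳ i = ≤-by-diff (ϵ i * (ι 2 * ι i)) (0≤* (0≤ϵ i) (0≤* (0≤ι 2) (0≤ι i)))
  (begin
    ι 2                                                        ≡⟨ cong (ι 2 *_) (ϵ-inverse i) ⟨
    ι 2 * (ϵ i * (ι 2 * ι i + ι 1))                            ≡⟨ lem (ϵ i) (ι i) ⟩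
    1ℚ * (ϵ i * (ι 2 * ι i + ι 2)) + ϵ i * (ι 2 * ι i)         ≡⟨ cong (λ o → o * (ϵ i * (ι 2 * ι i + ι 2)) + ϵ i * (ι 2 * ι i)) (ϵ-inverse i) ⟨
    ϵ i * (ι 2 * ι i + ι 1) * (ϵ i * (ι 2 * ι i + ι 2)) + ϵ i * (ι 2 * ι i) ≡⟨ lem′ (ϵ i) (ι i) ⟩
    ϵ i * ϵ i * ((ι 2 * ι i + ι 1) * (ι 2 * ι i + ι 2)) + ϵ i * (ι 2 * ι i) ∎)
  where
  open ≡-Reasoning
  lem : ∀ x m → ι 2 * (x * (ι 2 * m + ι 1)) ≡ 1ℚ * (x * (ι 2 * m + ι 2)) + x * (ι 2 * m)
  lem = solve-∀ ℚ-ring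
  lem′ = ring-solve 2 (λ x m → x ⊗ (nat 2 ⊗ m ⊕ nat 1) ⊗ (x ⊗ (nat 2 ⊗ m ⊕ nat 2)) ⊕ x ⊗ (nat 2 ⊗ m) ≐ x ⊗ x ⊗ ((nat 2 ⊗ m ⊕ nat 1) ⊗ (nat 2 ⊗ m ⊕ nat 2)) ⊕ x ⊗ (nat 2 ⊗ m)) refl
w²-bound (suc n) i = ≤-trans
  (≤-reflexive (cong (λ s → w (suc n) i * w (suc n) i * (e * (ι 2 * s + ι 2))) (trans (cong ι (ℕₚ.+-suc i n)) (ι-suc (i +ℕ n)))))
  (≤-trans (≤-by-diff (w n i * w n i * (e * (ι 2 * k + ι 2)) * (α * α))
    (0≤* (0≤* (0≤* (0≤w n i) (0≤w n i)) (0≤* (0≤2k+c i 1) (0≤2k+c (i +ℕ n) 2))) (0≤* (0≤ϵ (suc (i +ℕ n))) (0≤ϵ (suc (i +ℕ n)))))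
    (begin
      w n i * w n i * (e * (ι 2 * k + ι 2))                  ≡⟨ *-identityʳ _ ⟨
      w n i * w n i * (e * (ι 2 * k + ι 2)) * (1ℚ * 1ℚ)      ≡⟨ cong (λ o → w n i * w n i * (e * (ι 2 * k + ι 2)) * (o * o)) (ϵ-suc-inverse (i +ℕ n)) ⟨
      _ ≡⟨ lem (w n i) e k α ⟩
      _ ∎))
  (w²-bound n i))
  where
  open ≡-Reasoning
  e = ι 2 * ι i + ι 1
  k = ι (i +ℕ n)
  α = ϵ (suc (i +ℕ n))
  -- (2k+2)(2k+4) = (2k+3)² - 1
  lem = ring-solve 4 (λ w e k α → w ⊗ w ⊗ (e ⊗ (nat 2 ⊗ k ⊕ nat 2)) ⊗ (α ⊗ (nat 2 ⊗ k ⊕ nat 3) ⊗ (α ⊗ (nat 2 ⊗ k ⊕ nat 3)))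
    ≐ w ⊗ (nat 2 ⊗ k ⊕ nat 2) ⊗ α ⊗ (w ⊗ (nat 2 ⊗ k ⊕ nat 2) ⊗ α) ⊗ (e ⊗ (nat 2 ⊗ (k ⊕ nat 1) ⊕ nat 2)) ⊕ w ⊗ w ⊗ (e ⊗ (nat 2 ⊗ k ⊕ nat 2)) ⊗ (α ⊗ α)) refl

[n+1]w²≤ϵ : ∀ n i → (ι n + ι 1) * (w n i * w n i) ≤ ϵ i
[n+1]w²≤ϵ n i = ≤-trans
  (≤-by-diff (w n i * w n i * ι i) (0≤* (0≤* (0≤w n i) (0≤w n i)) (0≤ι i))
    (begin
      ½ * (w n i * w n i * (ι 2 * ι (i +ℕ n) + ι 2))       ≡⟨ cong (λ s → ½ * (w n i * w n i * (ι 2 * s + ι 2))) (ι-+ i n) ⟩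
      ½ * (w n i * w n i * (ι 2 * (ι i + ι n) + ι 2))      ≡⟨ lem (w n i) (ι i) (ι n) ⟩
      (ι n + ι 1) * (w n i * w n i) + w n i * w n i * ι i  ∎))
  (≤-trans
    (≤-reflexive (trans (sym (*-identityʳ _)) (trans (cong (½ * (w n i * w n i * a) *_) (sym (ϵ-inverse i))) (lem₁ (w n i) a (ϵ i) (ι 2 * ι i + ι 1)))))
    (≤-trans (*-monoˡ-≤-nonNeg (½ * ϵ i) {{nonNegative (0≤* {½} {ϵ i} (nonNegative⁻¹ ½) (0≤ϵ i))}} (w²-bound n i))
      (≤-reflexive (lem₂ (ϵ i)))))
  where
  open ≡-Reasoning
  a = ι 2 * ι (i +ℕ n) + ι 2
  lem : ∀ w i n → ½ * (w * w * (ι 2 * (i + n) + ι 2)) ≡ (n + ι 1) * (w * w) + w * w * i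
  lem = solve-∀ ℚ-ring
  lem₁ : ∀ w a x e → ½ * (w * w * a) * (x * e) ≡ ½ * x * (w * w * (e * a))
  lem₁ = solve-∀ ℚ-ring
  lem₂ : ∀ x → ½ * x * ι 2 ≡ x
  lem₂ = solve-∀ ℚ-ring

[n+1]T≤ϵ² : ∀ n i → (ι n + ι 1) * T n i ≤ ϵ i * ϵ i
[n+1]T≤ϵ² n i = ≤-trans (≤-reflexive (sym (*-assoc (ι n + ι 1) (w n i * w n i) (D n i))))
  (*-mono-≤ (0≤D n i) (0≤ϵ i) ([n+1]w²≤ϵ n i) (D≤ϵ n i))

-- A telescoping majorant: its increment is 3 `ϵ M` `ϵ (suc M)`, which dominates `ϵ M` squared
-- because 3(2M+1) - (2M+3) = 4M ≥ 0. Equality at M = 0 makes 3/2 the least factor for which this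
-- induction works.
sum-ϵ²-bound : ∀ M → sum (λ i → ϵ i * ϵ i) M ≤ + 3 / 2 * (1ℚ - ϵ M)
sum-ϵ²-bound zero = 0≤* (nonNegative⁻¹ (+ 3 / 2)) (p≤q⇒0≤q-p (ϵ≤1 0))
sum-ϵ²-bound (suc M) = ≤-trans (+-monoˡ-≤ (x * x) (sum-ϵ²-bound M))
  (≤-by-diff (x * (x * x′ * (ι 4 * ι M))) (0≤* (0≤ϵ M) (0≤* (0≤* (0≤ϵ M) (0≤ϵ (suc M))) (0≤* (0≤ι 4) (0≤ι M))))
    (begin
      + 3 / 2 * (1ℚ - x′)                     ≡⟨ lem₁ x x′ ⟩
      + 3 / 2 * (1ℚ - x) + + 3 / 2 * (x - x′) ≡⟨ cong (λ z → + 3 / 2 * (1ℚ - x) + + 3 / 2 * (z - x′)) (ϵ≡ϵ-suc+ M) ⟩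
      + 3 / 2 * (1ℚ - x) + + 3 / 2 * (x′ + ι 2 * (x * x′) - x′) ≡⟨ lem₂ x x′ ⟩
      + 3 / 2 * (1ℚ - x) + x * (ι 3 * x′ * 1ℚ + x - x * 1ℚ) ≡⟨ cong₂ (λ o q → + 3 / 2 * (1ℚ - x) + x * (ι 3 * x′ * o + x - x * q)) (ϵ-inverse M) (ϵ-suc-inverse M) ⟨
      _ ≡⟨ lem₃ x x′ (ι M) ⟩
      _ ∎))
  where
  open ≡-Reasoning
  x = ϵ M
  x′ = ϵ (suc M)
  lem₁ : ∀ x x′ → + 3 / 2 * (1ℚ - x′) ≡ + 3 / 2 * (1ℚ - x) + + 3 / 2 * (x - x′)
  lem₁ = solve-∀ ℚ-ring
  lem₂ : ∀ x x′ → + 3 / 2 * (1ℚ - x) + + 3 / 2 * (x′ + ι 2 * (x * x′) - x′) ≡ + 3 / 2 * (1ℚ - x) + x * (ι 3 * x′ * 1ℚ + x - x * 1ℚ)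
  lem₂ = solve-∀ ℚ-ring
  lem₃ = ring-solve 3 (λ x x′ m → Κ (+ 3 / 2) ⊗ (Κ 1ℚ ⊖ x) ⊕ x ⊗ (nat 3 ⊗ x′ ⊗ (x ⊗ (nat 2 ⊗ m ⊕ nat 1)) ⊕ x ⊖ x ⊗ (x′ ⊗ (nat 2 ⊗ m ⊕ nat 3)))
    ≐ Κ (+ 3 / 2) ⊗ (Κ 1ℚ ⊖ x) ⊕ x ⊗ x ⊕ x ⊗ (x ⊗ x′ ⊗ (nat 4 ⊗ m))) refl

[n+1]sumT≤3/2 : ∀ n M → (ι n + ι 1) * sum (T n) M ≤ + 3 / 2
[n+1]sumT≤3/2 n M = ≤-trans (go M) (≤-trans (sum-ϵ²-bound M)
  (≤-by-diff (+ 3 / 2 * ϵ M) (0≤* (nonNegative⁻¹ (+ 3 / 2)) (0≤ϵ M)) (lem (ϵ M))))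
  where
  lem : ∀ x → + 3 / 2 ≡ + 3 / 2 * (1ℚ - x) + + 3 / 2 * x
  lem = solve-∀ ℚ-ring
  go : ∀ M → (ι n + ι 1) * sum (T n) M ≤ sum (λ i → ϵ i * ϵ i) M
  go zero = ≤-reflexive (*-zeroʳ (ι n + ι 1))
  go (suc M) = ≤-trans (≤-reflexive (*-distribˡ-+ (ι n + ι 1) (sum (T n) M) (T n M))) (+-mono-≤ (go M) ([n+1]T≤ϵ² n M))

0≤sumT : ∀ n M → 0ℚ ≤ sum (T n) M
0≤sumT n zero    = ≤-refl
0≤sumT n (suc M) = 0≤+ (0≤sumT n M) (0≤T n M)

∣∣-≤ : ∀ {p q} → p ≤ q → - p ≤ q → ∣ p ∣ ≤ q
∣∣-≤ {p} p≤q -p≤q with ∣p∣≡p∨∣p∣≡-p p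
... | inj₁ eq = ≤-trans (≤-reflexive eq) p≤q
... | inj₂ eq = ≤-trans (≤-reflexive eq) -p≤q

-- `H` is x₁ - (x₂ + x₃) with nonnegative parts. The factors y are absorbed by α y ≤ 1, the linear
-- growth of h by h(t, y) ≤ h(t, 0)(y + 1), and w²(2M+1) ≤ 1/(M+1) from `w²-bound` gives the decay.
H-bound : ∀ n M → ∣ H n M ∣ ≤ ι 4 * ((τ n - ι 1) * (ι 2 * τ n + ι 1)) * inv M
H-bound n M = ∣∣-≤
  (≤-trans (≤-by-diff (x₂ + x₃) (0≤+ 0≤x₂ 0≤x₃) (split₁ P α y g (D n M) k)) (≤-trans x₁≤ (≤-trans 2g≤ last)))
  (≤-trans (≤-by-diff x₁ 0≤x₁ (split₂ P α y g (D n M) k)) (≤-trans (+-mono-≤ x₂≤ x₃≤) (≤-trans g+k≤ last)))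
  where
  m = ι n
  α = ϵ (suc (M +ℕ n))
  y = ι 2 * ι M
  e = ι 2 * ι M + ι 1
  P = w n M * w n M
  k = ι 2 * m + ι 3
  g = h k y
  g₀ = (k - ι 1) * (ι 2 * k + ι 1)
  x₁ = P * g * (α * y * (α * y)) * (D n M + α)
  x₂ = P * g * (α * y * α)
  x₃ = P * k * (α * y * (α * y))
  split₁ = ring-solve 6 (λ P α y g D k → P ⊗ g ⊗ (α ⊗ y ⊗ (α ⊗ y)) ⊗ (D ⊕ α)
    ≐ P ⊗ (α ⊗ α) ⊗ (y ⊗ y ⊗ g ⊗ (D ⊕ α) ⊖ y ⊗ g ⊖ k ⊗ y ⊗ y) ⊕ (P ⊗ g ⊗ (α ⊗ y ⊗ α) ⊕ P ⊗ k ⊗ (α ⊗ y ⊗ (α ⊗ y)))) refl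
  split₂ = ring-solve 6 (λ P α y g D k → P ⊗ g ⊗ (α ⊗ y ⊗ α) ⊕ P ⊗ k ⊗ (α ⊗ y ⊗ (α ⊗ y))
    ≐ ⊝ (P ⊗ (α ⊗ α) ⊗ (y ⊗ y ⊗ g ⊗ (D ⊕ α) ⊖ y ⊗ g ⊖ k ⊗ y ⊗ y)) ⊕ P ⊗ g ⊗ (α ⊗ y ⊗ (α ⊗ y)) ⊗ (D ⊕ α)) refl
  0≤m = 0≤ι n
  0≤y : 0ℚ ≤ y
  0≤y = 0≤* (0≤ι 2) (0≤ι M)
  0≤α = 0≤ϵ (suc (M +ℕ n))
  0≤αy : 0ℚ ≤ α * y
  0≤αy = 0≤* 0≤α 0≤y
  0≤P : 0ℚ ≤ P
  0≤P = 0≤* (0≤w n M) (0≤w n M)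
  0≤k : 0ℚ ≤ k
  0≤k = 0≤2k+c n 3
  0≤g₀ : 0ℚ ≤ g₀
  0≤g₀ = 0≤* (≤-trans (0≤2k+c n 2) (≤-reflexive (lem m))) (0≤+ (0≤* (0≤ι 2) 0≤k) (0≤ι 1))
    where
    lem : ∀ m → ι 2 * m + ι 2 ≡ ι 2 * m + ι 3 - ι 1
    lem = solve-∀ ℚ-ring
  0≤g : 0ℚ ≤ g
  0≤g = 0≤+ (0≤* (0≤* (0≤ι 2) 0≤k) 0≤y) 0≤g₀
  0≤D+α : 0ℚ ≤ D n M + α
  0≤D+α = 0≤+ (0≤D n M) 0≤α
  0≤x₁ : 0ℚ ≤ x₁
  0≤x₁ = 0≤* (0≤* (0≤* 0≤P 0≤g) (0≤* 0≤αy 0≤αy)) 0≤D+α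
  0≤x₂ : 0ℚ ≤ x₂
  0≤x₂ = 0≤* (0≤* 0≤P 0≤g) (0≤* 0≤αy 0≤α)
  0≤x₃ : 0ℚ ≤ x₃
  0≤x₃ = 0≤* (0≤* 0≤P 0≤k) (0≤* 0≤αy 0≤αy)
  0≤1 : 0ℚ ≤ 1ℚ
  0≤1 = 0≤ι 1
  αy≤1 : α * y ≤ 1ℚ
  αy≤1 = ≤-by-diff (α * (ι 2 * m + ι 3)) (0≤* 0≤α (0≤2k+c n 3))
    (trans (sym (ϵ-suc-inverse (M +ℕ n))) (trans (cong (λ s → α * (ι 2 * s + ι 3)) (ι-+ M n)) (lem α (ι M) m)))
    where
    lem : ∀ x i m → x * (ι 2 * (i + m) + ι 3) ≡ x * (ι 2 * i) + x * (ι 2 * m + ι 3)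
    lem = solve-∀ ℚ-ring
  α≤1 = ϵ≤1 (suc (M +ℕ n))
  αyαy≤1 : α * y * (α * y) ≤ 1ℚ
  αyαy≤1 = *-mono-≤ 0≤αy 0≤1 αy≤1 αy≤1
  αyα≤1 : α * y * α ≤ 1ℚ
  αyα≤1 = *-mono-≤ 0≤α 0≤1 αy≤1 α≤1
  D+α≤2 : D n M + α ≤ ι 2
  D+α≤2 = +-mono-≤ (≤-trans (D≤ϵ n M) (ϵ≤1 M)) α≤1
  0≤Pg : 0ℚ ≤ P * g
  0≤Pg = 0≤* 0≤P 0≤g
  x₁≤ : x₁ ≤ P * g * 1ℚ * ι 2
  x₁≤ = *-mono-≤ 0≤D+α (0≤* 0≤Pg 0≤1) (*-mono-≤ (0≤* 0≤αy 0≤αy) 0≤Pg ≤-refl αyαy≤1) D+α≤2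
  x₂≤ : x₂ ≤ P * g * 1ℚ
  x₂≤ = *-mono-≤ (0≤* 0≤αy 0≤α) 0≤Pg ≤-refl αyα≤1
  x₃≤ : x₃ ≤ P * k * 1ℚ
  x₃≤ = *-mono-≤ (0≤* 0≤αy 0≤αy) (0≤* 0≤P 0≤k) ≤-refl αyαy≤1
  rest = (ι 8 * m * m + ι 18 * m + ι 8) * y
  0≤rest : 0ℚ ≤ rest
  0≤rest = 0≤* (0≤+ (0≤+ (0≤* (0≤* (0≤ι 8) 0≤m) 0≤m) (0≤* (0≤ι 18) 0≤m)) (0≤ι 8)) 0≤y
  g₀e≡ = ring-solve 2 (λ m y → ((nat 2 ⊗ m ⊕ nat 3) ⊖ nat 1) ⊗ (nat 2 ⊗ (nat 2 ⊗ m ⊕ nat 3) ⊕ nat 1) ⊗ (y ⊕ nat 1)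
    ≐ nat 2 ⊗ (nat 2 ⊗ m ⊕ nat 3) ⊗ y ⊕ ((nat 2 ⊗ m ⊕ nat 3) ⊖ nat 1) ⊗ (nat 2 ⊗ (nat 2 ⊗ m ⊕ nat 3) ⊕ nat 1) ⊕ (nat 8 ⊗ m ⊗ m ⊕ nat 18 ⊗ m ⊕ nat 8) ⊗ y) refl
  g≤g₀e : g ≤ g₀ * e
  g≤g₀e = ≤-by-diff rest 0≤rest (g₀e≡ m y)
  k≤g₀e : k ≤ g₀ * e
  k≤g₀e = ≤-by-diff (g₀ * y + (ι 8 * m * m + ι 20 * m + ι 11))
    (0≤+ (0≤* 0≤g₀ 0≤y) (0≤+ (0≤+ (0≤* (0≤* (0≤ι 8) 0≤m) 0≤m) (0≤* (0≤ι 20) 0≤m)) (0≤ι 11))) (lem m y)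
    where
    lem = ring-solve 2 (λ m y → ((nat 2 ⊗ m ⊕ nat 3) ⊖ nat 1) ⊗ (nat 2 ⊗ (nat 2 ⊗ m ⊕ nat 3) ⊕ nat 1) ⊗ (y ⊕ nat 1)
      ≐ (nat 2 ⊗ m ⊕ nat 3) ⊕ (((nat 2 ⊗ m ⊕ nat 3) ⊖ nat 1) ⊗ (nat 2 ⊗ (nat 2 ⊗ m ⊕ nat 3) ⊕ nat 1) ⊗ y ⊕ (nat 8 ⊗ m ⊗ m ⊕ nat 20 ⊗ m ⊕ nat 11))) refl
  Q = P * (g₀ * e)
  0≤Q : 0ℚ ≤ Q
  0≤Q = 0≤* 0≤P (0≤* 0≤g₀ (0≤2k+c M 1))
  Pg≤Q : P * g ≤ Q
  Pg≤Q = *-mono-≤ 0≤g 0≤P ≤-refl g≤g₀e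
  Pk≤Q : P * k ≤ Q
  Pk≤Q = *-mono-≤ 0≤k 0≤P ≤-refl k≤g₀e
  2g≤ : P * g * 1ℚ * ι 2 ≤ Q * ι 4
  2g≤ = *-mono-≤ (0≤ι 2) 0≤Q (≤-trans (≤-reflexive (*-identityʳ (P * g))) Pg≤Q) (≤-by-diff (ι 2) (0≤ι 2) refl)
  g+k≤ : P * g * 1ℚ + P * k * 1ℚ ≤ Q * ι 4
  g+k≤ = ≤-trans (+-mono-≤ (≤-trans (≤-reflexive (*-identityʳ (P * g))) Pg≤Q) (≤-trans (≤-reflexive (*-identityʳ (P * k))) Pk≤Q))
    (≤-by-diff (Q * ι 2) (0≤* 0≤Q (0≤ι 2)) (lem Q))
    where
    lem : ∀ q → q * ι 4 ≡ q + q + q * ι 2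
    lem = solve-∀ ℚ-ring
  Pe≤ : P * e ≤ inv M
  Pe≤ = ≤-trans
    (≤-by-diff (θ M * (P * e * (ι 2 * m))) (0≤* (0≤θ M) (0≤* (0≤* 0≤P (0≤2k+c M 1)) (0≤* (0≤ι 2) 0≤m)))
      (trans (lem P e (θ M) (ι M) m) (cong (_+ θ M * (P * e * (ι 2 * m))) (trans (cong (P * e *_) (θ-inverse M)) (*-identityʳ (P * e))))))
    (≤-trans (*-monoˡ-≤-nonNeg (θ M) {{nonNegative (0≤θ M)}}
        (subst (λ s → P * (e * (ι 2 * s + ι 2)) ≤ ι 2) (ι-+ M n) (w²-bound n M)))
      (≤-reflexive (trans (*-comm (θ M) (ι 2)) (sym (inv≡2θ M)))))
    where
    lem : ∀ P e x i m → x * (P * (e * (ι 2 * (i + m) + ι 2))) ≡ P * e * (x * (ι 2 * i + ι 2)) + x * (P * e * (ι 2 * m))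
    lem = solve-∀ ℚ-ring
  last : Q * ι 4 ≤ ι 4 * g₀ * inv M
  last = ≤-trans (≤-reflexive (lem P g₀ e)) (*-monoˡ-≤-nonNeg (ι 4 * g₀) {{nonNegative (0≤* (0≤ι 4) 0≤g₀)}} Pe≤)
    where
    lem : ∀ P g e → P * (g * e) * ι 4 ≡ ι 4 * g * (P * e)
    lem = solve-∀ ℚ-ring

-- Sequences of order 1/M

-- K is merely required to exist, so it may vary with n without control when u does; `inv M` is
-- 1/(M+1), which makes M = 0 legitimate.
O[1/M] : (ℕ → ℚ) → Set
O[1/M] u = ∃[ K ] ∀ M → ∣ u M ∣ ≤ K * inv M

O-ext : ∀ {u v} → (∀ M → v M ≡ u M) → O[1/M] u → O[1/M] v
O-ext eq (K , bound) = K , λ M → ≤-trans (≤-reflexive (cong ∣_∣ (eq M))) (bound M)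

O-+ : ∀ {u v} → O[1/M] u → O[1/M] v → O[1/M] (λ M → u M + v M)
O-+ {u} {v} (K , bound) (K′ , bound′) = K + K′ , λ M →
  ≤-trans (∣p+q∣≤∣p∣+∣q∣ (u M) (v M)) (≤-trans (+-mono-≤ (bound M) (bound′ M)) (≤-reflexive (sym (*-distribʳ-+ (inv M) K K′))))

O-* : ∀ {u} c → O[1/M] u → O[1/M] (λ M → c * u M)
O-* {u} c (K , bound) = ∣ c ∣ * K , λ M →
  ≤-trans (≤-reflexive (∣p*q∣≡∣p∣*∣q∣ c (u M)))
    (≤-trans (*-monoˡ-≤-nonNeg ∣ c ∣ {{∣-∣-nonNeg c}} (bound M)) (≤-reflexive (sym (*-assoc ∣ c ∣ K (inv M)))))

O-H : ∀ n → O[1/M] (H n)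
O-H n = ι 4 * ((τ n - ι 1) * (ι 2 * τ n + ι 1)) , H-bound n

ϵ≤inv : ∀ M → ϵ M ≤ inv M
ϵ≤inv M = ≤-trans (≤-reflexive (ϵ≡θ+ M)) (≤-trans
  (+-monoʳ-≤ (θ M) (≤-trans (*-monoʳ-≤-nonNeg (θ M) {{nonNegative (0≤θ M)}} (ϵ≤1 M)) (≤-reflexive (*-identityˡ (θ M)))))
  (≤-reflexive (trans (lem (θ M)) (sym (inv≡2θ M)))))
  where
  lem : ∀ x → x + x ≡ ι 2 * x
  lem = solve-∀ ℚ-ring

O-intro : ∀ {u} → (∀ M → 0ℚ ≤ u M) → (∀ M → u M ≤ inv M) → O[1/M] u
O-intro {u} 0≤u u≤inv = 1ℚ , λ M →
  ≤-trans (≤-reflexive (0≤p⇒∣p∣≡p (0≤u M))) (≤-trans (u≤inv M) (≤-reflexive (sym (*-identityˡ (inv M)))))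

ϵ²≤ϵ : ∀ M → ϵ M * ϵ M ≤ ϵ M
ϵ²≤ϵ M = ≤-trans (*-monoˡ-≤-nonNeg (ϵ M) {{nonNegative (0≤ϵ M)}} (ϵ≤1 M)) (≤-reflexive (*-identityʳ (ϵ M)))

O-ϵ² : O[1/M] (λ M → ϵ M * ϵ M)
O-ϵ² = O-intro (λ M → 0≤* (0≤ϵ M) (0≤ϵ M)) (λ M → ≤-trans (ϵ²≤ϵ M) (ϵ≤inv M))

O-ϵ³ : O[1/M] (λ M → ϵ M * ϵ M * ϵ M)
O-ϵ³ = O-intro (λ M → 0≤* (0≤* (0≤ϵ M) (0≤ϵ M)) (0≤ϵ M))
  (λ M → ≤-trans (*-monoʳ-≤-nonNeg (ϵ M) {{nonNegative (0≤ϵ M)}} (≤-trans (ϵ²≤ϵ M) (ϵ≤1 M)))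
    (≤-trans (≤-reflexive (*-identityˡ (ϵ M))) (ϵ≤inv M)))

inverse-unique : ∀ x y d → x * d ≡ 1ℚ → y * d ≡ 1ℚ → x ≡ y
inverse-unique x y d xd yd = begin
  x            ≡⟨ *-identityʳ x ⟨
  x * 1ℚ       ≡⟨ cong (x *_) yd ⟨
  x * (y * d)  ≡⟨ lem x y d ⟩
  y * (x * d)  ≡⟨ cong (y *_) xd ⟩
  y * 1ℚ       ≡⟨ *-identityʳ y ⟩
  y            ∎
  where
  open ≡-Reasoning
  lem : ∀ x y d → x * (y * d) ≡ y * (x * d)
  lem = solve-∀ ℚ-ring

inv-double : ∀ M → inv (M +ℕ M) ≡ ϵ M
inv-double M = inverse-unique _ _ (ι (suc (M +ℕ M))) (inv*suc (M +ℕ M))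
  (trans (cong (ϵ M *_) (trans (ι-suc (M +ℕ M)) (trans (cong (_+ ι 1) (ι-+ M M)) (lem (ι M))))) (ϵ-inverse M))
  where
  lem : ∀ m → m + m + ι 1 ≡ ι 2 * m + ι 1
  lem = solve-∀ ℚ-ring

inv-suc-double : ∀ M → inv (suc (M +ℕ M)) ≡ θ M
inv-suc-double M = inverse-unique _ _ (ι (suc (suc (M +ℕ M)))) (inv*suc (suc (M +ℕ M)))
  (trans (cong (θ M *_) (trans (ι-suc (suc (M +ℕ M))) (trans (cong (_+ ι 1) (trans (ι-suc (M +ℕ M)) (cong (_+ ι 1) (ι-+ M M)))) (lem (ι M))))) (θ-inverse M))
  where
  lem : ∀ m → m + m + ι 1 + ι 1 ≡ ι 2 * m + ι 2
  lem = solve-∀ ℚ-ring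

-- Partial sums of ζ(3) and the sums S₀, S₁

abstract
  -- An opaque copy of `zeta3Partial`, so that the partial sums do not unfold; `ζ≡zeta3Partial`
  -- leads back to the original.
  ζ : ℕ → ℚ
  ζ = zeta3Partial

  ζ≡zeta3Partial : ∀ M → ζ M ≡ zeta3Partial M
  ζ≡zeta3Partial M = refl

  zeta3-suc : ∀ M → ζ (suc M) ≡ ζ M + inv M * inv M * inv M
  zeta3-suc M = cong (λ x → zeta3Partial M + x) (inverse-unique _ _ (ι (suc M *ℕ suc M *ℕ suc M)) (1/n*n≡1 (suc M *ℕ suc M *ℕ suc M))
    (trans (cong (inv M * inv M * inv M *_) (trans (ι-* (suc M *ℕ suc M) (suc M)) (cong (_* ι (suc M)) (ι-* (suc M) (suc M)))))
      (trans (lem (inv M) (ι (suc M))) (cong (λ o → o * o * o) (inv*suc M)))))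
    where
    lem : ∀ x d → x * x * x * (d * d * d) ≡ x * d * (x * d) * (x * d)
    lem = solve-∀ ℚ-ring

0≤inv³ : ∀ M → 0ℚ ≤ inv M * inv M * inv M
0≤inv³ M = 0≤* (0≤* (0≤inv M) (0≤inv M)) (0≤inv M)

zeta3-mono : ∀ M j → ζ M ≤ ζ (M +ℕ j)
zeta3-mono M zero rewrite ℕₚ.+-identityʳ M = ≤-refl
zeta3-mono M (suc j) rewrite ℕₚ.+-suc M j = ≤-trans (zeta3-mono M j) (≤-by-diff _ (0≤inv³ (M +ℕ j)) (zeta3-suc (M +ℕ j)))

inv-anti : ∀ M j → inv (M +ℕ j) ≤ inv M
inv-anti M j = ≤-by-diff (inv M * inv (M +ℕ j) * (ι (suc (M +ℕ j)) - ι (suc M)))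
  (0≤* (0≤* (0≤inv M) (0≤inv (M +ℕ j))) (≤-trans (0≤ι j) (≤-reflexive (sym (trans (cong (_- ι (suc M)) (ι-+ (suc M) j)) (lem (ι (suc M)) (ι j)))))))
  (reciprocal-diff (inv M) (inv (M +ℕ j)) (ι (suc M)) (ι (suc (M +ℕ j))) (inv*suc M) (inv*suc (M +ℕ j)))
  where
  lem : ∀ x y → x + y - x ≡ y
  lem = solve-∀ ℚ-ring

inv≤1 : ∀ M → inv M ≤ 1ℚ
inv≤1 M = ≤-by-diff (inv M * ι M) (0≤* (0≤inv M) (0≤ι M))
  (trans (sym (inv*suc M)) (trans (cong (inv M *_) (ι-suc M)) (lem (inv M) (ι M))))
  where
  lem : ∀ x m → x * (m + ι 1) ≡ x + x * m
  lem = solve-∀ ℚ-ring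

zeta3-increment-bound : ∀ M j → ζ (M +ℕ j) - ζ M ≤ ι j * (inv M * inv M * inv M)
zeta3-increment-bound M zero = ≤-reflexive (trans (cong (λ k → ζ k - ζ M) (ℕₚ.+-identityʳ M))
  (trans (+-inverseʳ (ζ M)) (sym (*-zeroˡ (inv M * inv M * inv M)))))
zeta3-increment-bound M (suc j) = ≤-trans
  (≤-reflexive (trans (cong (λ k → ζ k - ζ M) (ℕₚ.+-suc M j)) (trans (cong (_- ζ M) (zeta3-suc (M +ℕ j)))
    (lem (ζ (M +ℕ j)) (ζ M) (inv (M +ℕ j) * inv (M +ℕ j) * inv (M +ℕ j))))))
  (≤-trans (+-mono-≤ (zeta3-increment-bound M j) inv³-anti)
    (≤-reflexive (trans (lem′ (ι j) (inv M * inv M * inv M)) (cong (_* (inv M * inv M * inv M)) (sym (ι-suc j))))))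
  where
  lem : ∀ z z′ x → z + x - z′ ≡ z - z′ + x
  lem = solve-∀ ℚ-ring
  lem′ : ∀ j x → j * x + x ≡ (j + ι 1) * x
  lem′ = solve-∀ ℚ-ring
  inv³-anti : inv (M +ℕ j) * inv (M +ℕ j) * inv (M +ℕ j) ≤ inv M * inv M * inv M
  inv³-anti = *-mono-≤ (0≤inv (M +ℕ j)) (0≤* (0≤inv M) (0≤inv M)) (*-mono-≤ (0≤inv (M +ℕ j)) (0≤inv M) (inv-anti M j) (inv-anti M j)) (inv-anti M j)

ι*inv≤1 : ∀ M → ι M * inv M ≤ 1ℚ
ι*inv≤1 M = ≤-by-diff (inv M) (0≤inv M)
  (trans (sym (inv*suc M)) (trans (cong (inv M *_) (ι-suc M)) (lem (inv M) (ι M))))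
  where
  lem : ∀ x m → x * (m + ι 1) ≡ m * x + x
  lem = solve-∀ ℚ-ring

-- M new terms of size at most (M+1)⁻³. This is the mismatch between S₀ truncated at M, which
-- involves the partial sum up to 2M, and the partial sum up to M.
O-zeta3-doubling : O[1/M] (λ M → ζ (M +ℕ M) - ζ M)
O-zeta3-doubling = O-intro (λ M → p≤q⇒0≤q-p (zeta3-mono M M)) λ M →
  ≤-trans (zeta3-increment-bound M M) (≤-trans (≤-reflexive (lem (ι M) (inv M)))
    (≤-trans (*-mono-≤ {ι M * inv M * inv M} {1ℚ} {inv M} {inv M} (0≤inv M) (0≤ι 1) (*-mono-≤ (0≤inv M) (0≤ι 1) (ι*inv≤1 M) (inv≤1 M)) ≤-refl)
      (≤-reflexive (*-identityˡ (inv M)))))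
  where
  lem : ∀ m x → m * (x * x * x) ≡ m * x * x * x
  lem = solve-∀ ℚ-ring

-- `T 0 i` is the cube of 1/(2i+1): odd cubes are all cubes up to 2M minus the even ones, which
-- contribute an eighth of `ζ M`. Hence the coefficient 7/8 in the limit.
sum-T₀ : ∀ M → sum (T 0) M ≡ ζ (M +ℕ M) - + 1 / 8 * ζ M
sum-T₀ zero = sym (cong₂ (λ x y → x - + 1 / 8 * y) (ζ≡zeta3Partial 0) (ζ≡zeta3Partial 0))
sum-T₀ (suc M) = begin
  sum (T 0) M + ϵ M * ϵ M * ϵ M
    ≡⟨ cong (_+ ϵ M * ϵ M * ϵ M) (sum-T₀ M) ⟩
  z₂ - + 1 / 8 * z + ϵ M * ϵ M * ϵ M
    ≡⟨ lem z₂ z (ϵ M) (θ M) ⟩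
  z₂ + ϵ M * ϵ M * ϵ M + θ M * θ M * θ M - + 1 / 8 * (z + ι 2 * θ M * (ι 2 * θ M) * (ι 2 * θ M))
    ≡⟨ cong (λ x → z₂ + ϵ M * ϵ M * ϵ M + θ M * θ M * θ M - + 1 / 8 * (z + x * x * x)) (inv≡2θ M) ⟨
  z₂ + ϵ M * ϵ M * ϵ M + θ M * θ M * θ M - + 1 / 8 * (z + inv M * inv M * inv M)
    ≡⟨ cong₂ (λ x y → z₂ + x * x * x + y * y * y - + 1 / 8 * (z + inv M * inv M * inv M)) (inv-double M) (inv-suc-double M) ⟨
  z₂ + inv (M +ℕ M) * inv (M +ℕ M) * inv (M +ℕ M) + inv (suc (M +ℕ M)) * inv (suc (M +ℕ M)) * inv (suc (M +ℕ M)) - + 1 / 8 * (z + inv M * inv M * inv M)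
    ≡⟨ cong₂ (λ x y → x + inv (suc (M +ℕ M)) * inv (suc (M +ℕ M)) * inv (suc (M +ℕ M)) - + 1 / 8 * y) (zeta3-suc (M +ℕ M)) (zeta3-suc M) ⟨
  ζ (suc (M +ℕ M)) + inv (suc (M +ℕ M)) * inv (suc (M +ℕ M)) * inv (suc (M +ℕ M)) - + 1 / 8 * ζ (suc M)
    ≡⟨ cong (λ x → x - + 1 / 8 * ζ (suc M)) (zeta3-suc (suc (M +ℕ M))) ⟨
  ζ (suc (suc (M +ℕ M))) - + 1 / 8 * ζ (suc M)
    ≡⟨ cong (λ k → ζ (suc k) - + 1 / 8 * ζ (suc M)) (ℕₚ.+-suc M M) ⟨
  ζ (suc M +ℕ suc M) - + 1 / 8 * ζ (suc M) ∎
  where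
  open ≡-Reasoning
  z₂ = ζ (M +ℕ M)
  z = ζ M
  lem : ∀ a b x t → a - + 1 / 8 * b + x * x * x ≡ a + x * x * x + t * t * t - + 1 / 8 * (b + ι 2 * t * (ι 2 * t) * (ι 2 * t))
  lem = solve-∀ ℚ-ring

-- Partial fractions: x x′ = ½(x - x′) and x s x′ = ½(x + x′) reduce all mixed products to pure
-- powers of x and of x′.
T₁-telescoping : ∀ i → T 1 i ≡ ½ * T 0 i
  + (+ 1 / 4 * (ϵ (suc i) * ϵ (suc i) * ϵ (suc i)) - + 1 / 8 * (ϵ (suc i) * ϵ (suc i)))
  - (+ 1 / 4 * (ϵ i * ϵ i * ϵ i) - + 1 / 8 * (ϵ i * ϵ i))
T₁-telescoping i = begin
  T 1 i
    ≡⟨ T-suc 0 i s (cong (λ k → ι 2 * ι k + ι 2) (ℕₚ.+-identityʳ i)) ⟩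
  x * x * (ϵ (suc (i +ℕ 0)) * ϵ (suc (i +ℕ 0))) * (s * s * (x + ϵ (suc (i +ℕ 0))) - s)
    ≡⟨ cong (λ k → x * x * (ϵ (suc k) * ϵ (suc k)) * (s * s * (x + ϵ (suc k)) - s)) (ℕₚ.+-identityʳ i) ⟩
  x * x * (x′ * x′) * (s * s * (x + x′) - s)
    ≡⟨ lem₁ x x′ s ⟩
  x * s * x′ * (x * s * x′) * (x + x′) - x * s * x′ * (x * x′)
    ≡⟨ cong₂ (λ p q → p * p * (x + x′) - p * q) xsx′ xx′ ⟩
  ½ * (x + x′) * (½ * (x + x′)) * (x + x′) - ½ * (x + x′) * (½ * (x - x′))
    ≡⟨ lem₂ x x′ ⟩
  + 1 / 4 * (x * x * x) + + 1 / 4 * (x′ * x′ * x′) + + 3 / 4 * (x * x′) * (x + x′) - ½ * (x + x′) * (½ * (x - x′))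
    ≡⟨ cong (λ q → + 1 / 4 * (x * x * x) + + 1 / 4 * (x′ * x′ * x′) + + 3 / 4 * q * (x + x′) - ½ * (x + x′) * (½ * (x - x′))) xx′ ⟩
  + 1 / 4 * (x * x * x) + + 1 / 4 * (x′ * x′ * x′) + + 3 / 4 * (½ * (x - x′)) * (x + x′) - ½ * (x + x′) * (½ * (x - x′))
    ≡⟨ lem₃ x x′ ⟩
  _ ∎
  where
  open ≡-Reasoning
  x = ϵ i
  x′ = ϵ (suc i)
  s = ι 2 * ι i + ι 2
  xx′ : x * x′ ≡ ½ * (x - x′)
  xx′ = trans (lem x x′) (cong (λ z → ½ * (z - x′)) (sym (ϵ≡ϵ-suc+ i)))
    where
    lem : ∀ x x′ → x * x′ ≡ ½ * (x′ + ι 2 * (x * x′) - x′)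
    lem = solve-∀ ℚ-ring
  xsx′ : x * s * x′ ≡ ½ * (x + x′)
  xsx′ = trans (lem x x′ (ι i)) (trans (cong₂ (λ o q → o * x′ + q) (ϵ-inverse i) xx′) (lem′ x x′))
    where
    lem : ∀ x x′ i → x * (ι 2 * i + ι 2) * x′ ≡ x * (ι 2 * i + ι 1) * x′ + x * x′
    lem = solve-∀ ℚ-ring
    lem′ : ∀ x x′ → 1ℚ * x′ + ½ * (x - x′) ≡ ½ * (x + x′)
    lem′ = solve-∀ ℚ-ring
  lem₁ : ∀ x x′ s → x * x * (x′ * x′) * (s * s * (x + x′) - s) ≡ x * s * x′ * (x * s * x′) * (x + x′) - x * s * x′ * (x * x′)
  lem₁ = solve-∀ ℚ-ring
  lem₂ = ring-solve 2 (λ x x′ → Κ ½ ⊗ (x ⊕ x′) ⊗ (Κ ½ ⊗ (x ⊕ x′)) ⊗ (x ⊕ x′) ⊖ Κ ½ ⊗ (x ⊕ x′) ⊗ (Κ ½ ⊗ (x ⊖ x′))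
    ≐ Κ (+ 1 / 4) ⊗ (x ⊗ x ⊗ x) ⊕ Κ (+ 1 / 4) ⊗ (x′ ⊗ x′ ⊗ x′) ⊕ Κ (+ 3 / 4) ⊗ (x ⊗ x′) ⊗ (x ⊕ x′) ⊖ Κ ½ ⊗ (x ⊕ x′) ⊗ (Κ ½ ⊗ (x ⊖ x′))) refl
  lem₃ = ring-solve 2 (λ x x′ → Κ (+ 1 / 4) ⊗ (x ⊗ x ⊗ x) ⊕ Κ (+ 1 / 4) ⊗ (x′ ⊗ x′ ⊗ x′) ⊕ Κ (+ 3 / 4) ⊗ (Κ ½ ⊗ (x ⊖ x′)) ⊗ (x ⊕ x′) ⊖ Κ ½ ⊗ (x ⊕ x′) ⊗ (Κ ½ ⊗ (x ⊖ x′))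
    ≐ Κ ½ ⊗ (x ⊗ x ⊗ x) ⊕ (Κ (+ 1 / 4) ⊗ (x′ ⊗ x′ ⊗ x′) ⊖ Κ (+ 1 / 8) ⊗ (x′ ⊗ x′)) ⊖ (Κ (+ 1 / 4) ⊗ (x ⊗ x ⊗ x) ⊖ Κ (+ 1 / 8) ⊗ (x ⊗ x))) refl

ϵ₀≡1 : ϵ 0 ≡ 1ℚ
ϵ₀≡1 = trans (sym (*-identityʳ (ϵ 0))) (ϵ-inverse 0)

-- The constant is minus the bracket at M = 0, 1/4 - 1/8. It is matched by -2 times b₁/16, which
-- fixes the coefficient -2 of bₙ.
sum-T₁ : ∀ M → sum (T 1) M ≡ ½ * sum (T 0) M - + 1 / 8 + (+ 1 / 4 * (ϵ M * ϵ M * ϵ M) - + 1 / 8 * (ϵ M * ϵ M))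
sum-T₁ zero rewrite ϵ₀≡1 = refl
sum-T₁ (suc M) = trans (cong₂ _+_ (sum-T₁ M) (T₁-telescoping M))
  (lem (sum (T 0) M) (T 0 M) (+ 1 / 4 * (ϵ M * ϵ M * ϵ M) - + 1 / 8 * (ϵ M * ϵ M)) (+ 1 / 4 * (ϵ (suc M) * ϵ (suc M) * ϵ (suc M)) - + 1 / 8 * (ϵ (suc M) * ϵ (suc M))))
  where
  lem : ∀ s t p q → ½ * s - + 1 / 8 + p + (½ * t + q - p) ≡ ½ * (s + t) - + 1 / 8 + q
  lem = solve-∀ ℚ-ring

H-zero : ∀ n → H n 0 ≡ 0ℚ
H-zero n = lem (w n 0 * w n 0) (ϵ (suc n)) (τ n) (D n 0)
  where
  lem = ring-solve 4 (λ P α t D → P ⊗ (α ⊗ α) ⊗ (nat 2 ⊗ nat 0 ⊗ (nat 2 ⊗ nat 0) ⊗ (nat 2 ⊗ t ⊗ (nat 2 ⊗ nat 0) ⊕ (t ⊖ nat 1) ⊗ (nat 2 ⊗ t ⊕ nat 1)) ⊗ (D ⊕ α)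
    ⊖ nat 2 ⊗ nat 0 ⊗ (nat 2 ⊗ t ⊗ (nat 2 ⊗ nat 0) ⊕ (t ⊖ nat 1) ⊗ (nat 2 ⊗ t ⊕ nat 1)) ⊖ t ⊗ (nat 2 ⊗ nat 0) ⊗ (nat 2 ⊗ nat 0)) ≐ Κ 0ℚ) refl

-- The telescoper carries a factor y and so vanishes at i = 0; only the upper boundary term
-- survives.
sum-T-recurrence : ∀ n M → let t = τ n in
  c₂ t * sum (T (suc (suc n))) M - c₁ t * sum (T (suc n)) M + c₀ t * sum (T n) M ≡ - H n M
sum-T-recurrence n zero = trans (lem (c₂ t) (c₁ t) (c₀ t)) (cong -_ (sym (H-zero n)))
  where
  t = τ n
  lem : ∀ p q r → p * 0ℚ - q * 0ℚ + r * 0ℚ ≡ - 0ℚ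
  lem = solve-∀ ℚ-ring
sum-T-recurrence n (suc M) = trans
  (lem (c₂ t) (c₁ t) (c₀ t) (sum (T (suc (suc n))) M) (sum (T (suc n)) M) (sum (T n) M) (T (suc (suc n)) M) (T (suc n) M) (T n M))
  (trans (cong₂ _+_ (sum-T-recurrence n M) (T-recurrence n M)) (lem′ (H n M) (H n (suc M))))
  where
  t = τ n
  lem : ∀ p q r s t u s′ t′ u′ → p * (s + s′) - q * (t + t′) + r * (u + u′) ≡ p * s - q * t + r * u + (p * s′ - q * t′ + r * u′)
  lem = solve-∀ ℚ-ring
  lem′ : ∀ x y → - x + (x - y) ≡ - y
  lem′ = solve-∀ ℚ-ring

-- The truncated linear form in 1 and ζ(3)

16⁻^ : ℕ → ℚ
16⁻^ zero    = 1ℚ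
16⁻^ (suc n) = 16⁻^ n * (+ 1 / 16)

NormalisedRecurrence : (ℕ → ℚ) → Set
NormalisedRecurrence v = ∀ n → c₂ (τ n) * v (suc (suc n)) - c₁ (τ n) * v (suc n) + c₀ (τ n) * v n ≡ 0ℚ

normalise-recurrence : ∀ u → Recurrence u → NormalisedRecurrence (λ n → u n * 16⁻^ n)
normalise-recurrence u rec n = trans (lem (ι n) (u (suc (suc n))) (u (suc n)) (u n) (16⁻^ n))
  -- The factor compares leading coefficients: 8(n+2)³/16² = (n+2)³/32.
  (trans (cong (+ 1 / 32 * 16⁻^ n *_) (rec n)) (*-zeroʳ (+ 1 / 32 * 16⁻^ n)))
  where
  lem = ring-solve 5 (λ m u₂ u₁ u₀ q →
    ((nat 2 ⊗ m ⊕ nat 3) ⊕ nat 1) ⊗ ((nat 2 ⊗ m ⊕ nat 3) ⊕ nat 1) ⊗ ((nat 2 ⊗ m ⊕ nat 3) ⊕ nat 1) ⊗ (u₂ ⊗ (q ⊗ (Κ (+ 1 / 16)) ⊗ (Κ (+ 1 / 16))))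
    ⊖ nat 2 ⊗ (nat 2 ⊗ m ⊕ nat 3) ⊗ ((nat 2 ⊗ m ⊕ nat 3) ⊗ (nat 2 ⊗ m ⊕ nat 3) ⊕ nat 1) ⊗ (u₁ ⊗ (q ⊗ (Κ (+ 1 / 16))))
    ⊕ ((nat 2 ⊗ m ⊕ nat 3) ⊖ nat 1) ⊗ ((nat 2 ⊗ m ⊕ nat 3) ⊖ nat 1) ⊗ ((nat 2 ⊗ m ⊕ nat 3) ⊖ nat 1) ⊗ (u₀ ⊗ q)
    ≐ Κ (+ 1 / 32) ⊗ q ⊗ ((m ⊕ nat 2) ⊗ (m ⊕ nat 2) ⊗ (m ⊕ nat 2) ⊗ u₂
      ⊖ nat 8 ⊗ (nat 2 ⊗ m ⊕ nat 3) ⊗ (nat 2 ⊗ m ⊗ m ⊕ nat 6 ⊗ m ⊕ nat 5) ⊗ u₁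
      ⊕ nat 256 ⊗ (m ⊕ nat 1) ⊗ (m ⊕ nat 1) ⊗ (m ⊕ nat 1) ⊗ u₀)) refl

module Remainder (v u : ℕ → ℚ) (v-rec : NormalisedRecurrence v) (u-rec : NormalisedRecurrence u)
  (v₀ : v 0 ≡ 1ℚ) (v₁ : v 1 ≡ ½) (u₀ : u 0 ≡ 0ℚ) (u₁ : u 1 ≡ + 1 / 16) where

  -- It satisfies the normalised recurrence with `H n M` on the right, so being O(1/M) spreads from
  -- n = 0, 1 to every n, with a constant that depends on n.
  R : ℕ → ℕ → ℚ
  R n M = + 7 / 8 * ζ M * v n - ι 2 * u n - sum (T n) M

  R₀ : ∀ M → R 0 M ≡ - 1ℚ * (ζ (M +ℕ M) - ζ M)
  R₀ M = trans (cong₂ (λ p r → + 7 / 8 * ζ M * p - ι 2 * r - sum (T 0) M) v₀ u₀)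
    (trans (cong (λ s → + 7 / 8 * ζ M * 1ℚ - ι 2 * 0ℚ - s) (sum-T₀ M)) (lem (ζ M) (ζ (M +ℕ M))))
    where
    lem : ∀ z z₂ → + 7 / 8 * z * 1ℚ - ι 2 * 0ℚ - (z₂ - + 1 / 8 * z) ≡ - 1ℚ * (z₂ - z)
    lem = solve-∀ ℚ-ring

  R₁ : ∀ M → R 1 M ≡ ½ * R 0 M + (- (+ 1 / 4) * (ϵ M * ϵ M * ϵ M) + + 1 / 8 * (ϵ M * ϵ M))
  R₁ M = trans (cong₂ (λ p r → + 7 / 8 * ζ M * p - ι 2 * r - sum (T 1) M) v₁ u₁)
    (trans (cong (λ s → + 7 / 8 * ζ M * ½ - ι 2 * (+ 1 / 16) - s) (sum-T₁ M))
    (trans (lem (ζ M) (sum (T 0) M) (ϵ M))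
      (cong₂ (λ p r → ½ * (+ 7 / 8 * ζ M * p - ι 2 * r - sum (T 0) M) + (- (+ 1 / 4) * (ϵ M * ϵ M * ϵ M) + + 1 / 8 * (ϵ M * ϵ M))) (sym v₀) (sym u₀))))
    where
    lem = ring-solve 3 (λ z s x → Κ (+ 7 / 8) ⊗ z ⊗ Κ ½ ⊖ nat 2 ⊗ (Κ (+ 1 / 16)) ⊖ (Κ ½ ⊗ s ⊖ Κ (+ 1 / 8) ⊕ (Κ (+ 1 / 4) ⊗ (x ⊗ x ⊗ x) ⊖ Κ (+ 1 / 8) ⊗ (x ⊗ x)))
      ≐ Κ ½ ⊗ (Κ (+ 7 / 8) ⊗ z ⊗ Κ 1ℚ ⊖ nat 2 ⊗ Κ 0ℚ ⊖ s) ⊕ (⊝ (Κ (+ 1 / 4)) ⊗ (x ⊗ x ⊗ x) ⊕ Κ (+ 1 / 8) ⊗ (x ⊗ x))) refl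

  c₂⁻¹ : ℕ → ℚ
  c₂⁻¹ n = + 1 / 8 * (inv (suc n) * inv (suc n) * inv (suc n))

  c₂⁻¹*c₂ : ∀ n → c₂⁻¹ n * c₂ (τ n) ≡ 1ℚ
  c₂⁻¹*c₂ n = trans (lem (inv (suc n)) (ι n)) (cong (λ o → o * o * o)
      (trans (cong (inv (suc n) *_) (sym (ι-+ 2 n))) (inv*suc (suc n))))
    where
    lem = ring-solve 2 (λ x m → Κ (+ 1 / 8) ⊗ (x ⊗ x ⊗ x) ⊗ (((nat 2 ⊗ m ⊕ nat 3) ⊕ nat 1) ⊗ ((nat 2 ⊗ m ⊕ nat 3) ⊕ nat 1) ⊗ ((nat 2 ⊗ m ⊕ nat 3) ⊕ nat 1)) ≐ x ⊗ (nat 2 ⊕ m) ⊗ (x ⊗ (nat 2 ⊕ m)) ⊗ (x ⊗ (nat 2 ⊕ m))) refl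

  R-step : ∀ n M → R (suc (suc n)) M ≡ c₂⁻¹ n * (c₁ (τ n) * R (suc n) M + (- c₀ (τ n) * R n M + H n M))
  R-step n M = begin
    r₂                                 ≡⟨ *-identityˡ r₂ ⟨
    1ℚ * r₂                            ≡⟨ cong (_* r₂) (c₂⁻¹*c₂ n) ⟨
    c₂⁻¹ n * c₂ (τ n) * r₂             ≡⟨ *-assoc (c₂⁻¹ n) (c₂ (τ n)) r₂ ⟩
    c₂⁻¹ n * (c₂ (τ n) * r₂)           ≡⟨ cong (c₂⁻¹ n *_) step ⟩
    c₂⁻¹ n * (c₁ (τ n) * R (suc n) M + (- c₀ (τ n) * R n M + H n M)) ∎
    where
    open ≡-Reasoning
    r₂ = R (suc (suc n)) M
    lem = ring-solve 14 (λ c₂ c₁ c₀ z v₂ v₁ v₀ u₂ u₁ u₀ s₂ s₁ s₀ H →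
      c₂ ⊗ (Κ (+ 7 / 8) ⊗ z ⊗ v₂ ⊖ nat 2 ⊗ u₂ ⊖ s₂)
      ≐ c₁ ⊗ (Κ (+ 7 / 8) ⊗ z ⊗ v₁ ⊖ nat 2 ⊗ u₁ ⊖ s₁) ⊕ (⊝ c₀ ⊗ (Κ (+ 7 / 8) ⊗ z ⊗ v₀ ⊖ nat 2 ⊗ u₀ ⊖ s₀) ⊕ H)
        ⊕ (Κ (+ 7 / 8) ⊗ z ⊗ (c₂ ⊗ v₂ ⊖ c₁ ⊗ v₁ ⊕ c₀ ⊗ v₀) ⊖ nat 2 ⊗ (c₂ ⊗ u₂ ⊖ c₁ ⊗ u₁ ⊕ c₀ ⊗ u₀) ⊖ (c₂ ⊗ s₂ ⊖ c₁ ⊗ s₁ ⊕ c₀ ⊗ s₀ ⊕ H))) refl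
    lem′ : ∀ x z H → x + (+ 7 / 8 * z * 0ℚ - ι 2 * 0ℚ - (- H + H)) ≡ x
    lem′ = solve-∀ ℚ-ring
    step : c₂ (τ n) * r₂ ≡ c₁ (τ n) * R (suc n) M + (- c₀ (τ n) * R n M + H n M)
    step = trans (lem (c₂ (τ n)) (c₁ (τ n)) (c₀ (τ n)) (ζ M) (v (suc (suc n))) (v (suc n)) (v n) (u (suc (suc n))) (u (suc n)) (u n)
        (sum (T (suc (suc n))) M) (sum (T (suc n)) M) (sum (T n) M) (H n M))
      (trans (cong₂ (λ p r → x + (+ 7 / 8 * ζ M * p - ι 2 * r - (c₂ (τ n) * sum (T (suc (suc n))) M - c₁ (τ n) * sum (T (suc n)) M + c₀ (τ n) * sum (T n) M + H n M)))
          (v-rec n) (u-rec n))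
        (trans (cong (λ s → x + (+ 7 / 8 * ζ M * 0ℚ - ι 2 * 0ℚ - (s + H n M))) (sum-T-recurrence n M))
          (lem′ x (ζ M) (H n M))))
      where x = c₁ (τ n) * R (suc n) M + (- c₀ (τ n) * R n M + H n M)

  O-R-pair : ∀ n → O[1/M] (R n) × O[1/M] (R (suc n))
  O-R-pair zero = O-R₀ , O-ext R₁ (O-+ (O-* ½ O-R₀) (O-+ (O-* (- (+ 1 / 4)) O-ϵ³) (O-* (+ 1 / 8) O-ϵ²)))
    where
    O-R₀ : O[1/M] (R 0)
    O-R₀ = O-ext R₀ (O-* (- 1ℚ) O-zeta3-doubling)
  O-R-pair (suc n) = let o₀ , o₁ = O-R-pair n in
    o₁ , O-ext (R-step n) (O-* (c₂⁻¹ n) (O-+ (O-* (c₁ (τ n)) o₁) (O-+ (O-* (- c₀ (τ n)) o₀) (O-H n))))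

  O-R : ∀ n → O[1/M] (R n)
  O-R n = proj₁ (O-R-pair n)

-- Logarithmic growth of (n+1) aₙ/16ⁿ

ι-mono : ∀ {m n} → m ≤ℕ n → ι m ≤ ι n
ι-mono {m} {n} m≤n = ≤-by-diff (ι (n ∸ m)) (0≤ι (n ∸ m)) (trans (cong ι (sym (ℕₚ.m+[n∸m]≡n m≤n))) (ι-+ m (n ∸ m)))

inv-anti-≤ : ∀ {m n} → m ≤ℕ n → inv n ≤ inv m
inv-anti-≤ {m} {n} m≤n = subst (λ k → inv k ≤ inv m) (ℕₚ.m+[n∸m]≡n m≤n) (inv-anti m (n ∸ m))

-- With yₙ = (n+1) vₙ, the recurrence reads
-- 2(n+2)⁴ (yₙ₊₂ - yₙ₊₁) = 2(n+1)²(n+2)(n+3) (yₙ₊₁ - yₙ) + (n+1) yₙ₊₁.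
increment-step : ∀ m s s′ v₂ v₁ v₀ j c → m + ι 1 ≡ s → s + ι 1 ≡ s′ → 0ℚ ≤ m → 0ℚ ≤ j → j * (ι 2 + m) ≡ 1ℚ →
  c₂ (ι 2 * m + ι 3) * v₂ - c₁ (ι 2 * m + ι 3) * v₁ + c₀ (ι 2 * m + ι 3) * v₀ ≡ 0ℚ → 0ℚ ≤ (s + ι 1) * v₁ →
  c * (m + ι 2) ≤ (m + ι 1) * (m + ι 1) * ((s + ι 1) * v₁ - (m + ι 1) * v₀) →
  c * (s + ι 2) ≤ (s + ι 1) * (s + ι 1) * ((s′ + ι 1) * v₂ - (s + ι 1) * v₁)
increment-step m _ _ v₂ v₁ v₀ j c refl refl 0≤m 0≤j j*≡1 v-rec 0≤y′ bound = ≤-by-diff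
  (j * (m + ι 3) * ((m + ι 1) * (m + ι 1) * ((m + ι 1 + ι 1) * v₁ - (m + ι 1) * v₀) - c * (m + ι 2))
    + ½ * (j * j) * ((m + ι 1) * ((m + ι 1 + ι 1) * v₁)))
  (0≤+ (0≤* (0≤* 0≤j (0≤+ 0≤m (0≤ι 3))) (p≤q⇒0≤q-p bound))
       (0≤* (0≤* (nonNegative⁻¹ ½) (0≤* 0≤j 0≤j)) (0≤* (0≤+ 0≤m (0≤ι 1)) 0≤y′)))
  (begin
    _ ≡⟨ lem₁ m (v₂) (v₁) ⟩
    _ ≡⟨ cong (λ o → (m + ι 1 + ι 1) * (m + ι 1 + ι 1) * ((m + ι 1 + ι 1 + ι 1) * v₂ - (m + ι 1 + ι 1) * v₁) * (o * o)) j*≡1 ⟨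
    _ ≡⟨ lem₂ m (v₂) (v₁) (v₀) j c ⟩
    _ ≡⟨ cong₂ (λ r o → + 1 / 8 * (j * j) * ((m + ι 2) * (m + ι 3)) * r + (c * (m + ι 3) * o
           + (j * (m + ι 3) * ((m + ι 1) * (m + ι 1) * ((m + ι 1 + ι 1) * v₁ - (m + ι 1) * v₀) * o - c * (m + ι 2))
           + ½ * (j * j) * ((m + ι 1) * ((m + ι 1 + ι 1) * v₁)))))
         v-rec j*≡1 ⟩
    _ ≡⟨ lem₃ m (v₁) (v₀) j c ⟩
    _ ∎)
  where
  open ≡-Reasoning
  lem₁ = ring-solve 3 (λ m v₂ v₁ →
    (m ⊕ nat 1 ⊕ nat 1) ⊗ (m ⊕ nat 1 ⊕ nat 1) ⊗ ((m ⊕ nat 1 ⊕ nat 1 ⊕ nat 1) ⊗ v₂ ⊖ (m ⊕ nat 1 ⊕ nat 1) ⊗ v₁)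
    ≐ (m ⊕ nat 1 ⊕ nat 1) ⊗ (m ⊕ nat 1 ⊕ nat 1) ⊗ ((m ⊕ nat 1 ⊕ nat 1 ⊕ nat 1) ⊗ v₂ ⊖ (m ⊕ nat 1 ⊕ nat 1) ⊗ v₁) ⊗ (Κ 1ℚ ⊗ Κ 1ℚ)) refl
  lem₂ = ring-solve 6 (λ m v₂ v₁ v₀ j c →
    (m ⊕ nat 1 ⊕ nat 1) ⊗ (m ⊕ nat 1 ⊕ nat 1) ⊗ ((m ⊕ nat 1 ⊕ nat 1 ⊕ nat 1) ⊗ v₂ ⊖ (m ⊕ nat 1 ⊕ nat 1) ⊗ v₁) ⊗ (j ⊗ (nat 2 ⊕ m) ⊗ (j ⊗ (nat 2 ⊕ m)))
    ≐ Κ (+ 1 / 8) ⊗ (j ⊗ j) ⊗ ((m ⊕ nat 2) ⊗ (m ⊕ nat 3)) ⊗ (((nat 2 ⊗ m ⊕ nat 3) ⊕ nat 1) ⊗ ((nat 2 ⊗ m ⊕ nat 3) ⊕ nat 1) ⊗ ((nat 2 ⊗ m ⊕ nat 3) ⊕ nat 1) ⊗ v₂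
        ⊖ nat 2 ⊗ (nat 2 ⊗ m ⊕ nat 3) ⊗ ((nat 2 ⊗ m ⊕ nat 3) ⊗ (nat 2 ⊗ m ⊕ nat 3) ⊕ nat 1) ⊗ v₁ ⊕ ((nat 2 ⊗ m ⊕ nat 3) ⊖ nat 1) ⊗ ((nat 2 ⊗ m ⊕ nat 3) ⊖ nat 1) ⊗ ((nat 2 ⊗ m ⊕ nat 3) ⊖ nat 1) ⊗ v₀)
      ⊕ (c ⊗ (m ⊕ nat 3) ⊗ (j ⊗ (nat 2 ⊕ m))
      ⊕ (j ⊗ (m ⊕ nat 3) ⊗ ((m ⊕ nat 1) ⊗ (m ⊕ nat 1) ⊗ ((m ⊕ nat 1 ⊕ nat 1) ⊗ v₁ ⊖ (m ⊕ nat 1) ⊗ v₀) ⊗ (j ⊗ (nat 2 ⊕ m)) ⊖ c ⊗ (m ⊕ nat 2))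
      ⊕ Κ ½ ⊗ (j ⊗ j) ⊗ ((m ⊕ nat 1) ⊗ ((m ⊕ nat 1 ⊕ nat 1) ⊗ v₁))))) refl
  lem₃ = ring-solve 5 (λ m v₁ v₀ j c →
    Κ (+ 1 / 8) ⊗ (j ⊗ j) ⊗ ((m ⊕ nat 2) ⊗ (m ⊕ nat 3)) ⊗ Κ 0ℚ
      ⊕ (c ⊗ (m ⊕ nat 3) ⊗ Κ 1ℚ
      ⊕ (j ⊗ (m ⊕ nat 3) ⊗ ((m ⊕ nat 1) ⊗ (m ⊕ nat 1) ⊗ ((m ⊕ nat 1 ⊕ nat 1) ⊗ v₁ ⊖ (m ⊕ nat 1) ⊗ v₀) ⊗ Κ 1ℚ ⊖ c ⊗ (m ⊕ nat 2))
      ⊕ Κ ½ ⊗ (j ⊗ j) ⊗ ((m ⊕ nat 1) ⊗ ((m ⊕ nat 1 ⊕ nat 1) ⊗ v₁))))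
    ≐ c ⊗ (m ⊕ nat 1 ⊕ nat 2) ⊕ (j ⊗ (m ⊕ nat 3) ⊗ ((m ⊕ nat 1) ⊗ (m ⊕ nat 1) ⊗ ((m ⊕ nat 1 ⊕ nat 1) ⊗ v₁ ⊖ (m ⊕ nat 1) ⊗ v₀) ⊖ c ⊗ (m ⊕ nat 2))
      ⊕ Κ ½ ⊗ (j ⊗ j) ⊗ ((m ⊕ nat 1) ⊗ ((m ⊕ nat 1 ⊕ nat 1) ⊗ v₁)))) refl

module Growth (v : ℕ → ℚ) (v-rec : NormalisedRecurrence v) (v₀ : v 0 ≡ 1ℚ) (v₁ : v 1 ≡ ½) where

  y : ℕ → ℚ
  y n = (ι n + ι 1) * v n

  -- Makes the invariant an equality at n = 1: δ₁ = 4(33/32 - 1) = 1/8 = 3c.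
  c : ℚ
  c = + 1 / 24

  -- The recurrence makes δₙ/(n+2) nondecreasing while y ≥ 0, so one initial bound yields increments
  -- of y of harmonic size c/(n+1).
  δ : ℕ → ℚ
  δ n = (ι n + ι 1) * (ι n + ι 1) * (y (suc n) - y n)

  δ-step : ∀ n → 0ℚ ≤ y (suc n) → c * (ι n + ι 2) ≤ δ n → c * (ι (suc n) + ι 2) ≤ δ (suc n)
  δ-step n 0≤y′ bound = increment-step (ι n) (ι (suc n)) (ι (suc (suc n))) (v (suc (suc n))) (v (suc n)) (v n) (inv (suc n)) c
    (sym (ι-suc n)) (sym (ι-suc (suc n))) (0≤ι n) (0≤inv (suc n))
    (trans (cong (inv (suc n) *_) (sym (ι-+ 2 n))) (inv*suc (suc n))) (v-rec n) 0≤y′ bound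

  δ-bound⇒increment : ∀ n → c * (ι n + ι 2) ≤ δ n → y n + c * inv n ≤ y (suc n)
  δ-bound⇒increment n bound = ≤-by-diff
    -- The last summand is c times the surplus (n+2)/(n+1)² - 1/(n+1).
    (inv n * inv n * (δ n - c * (ι n + ι 2)) + c * (inv n * inv n))
    (0≤+ (0≤* (0≤* (0≤inv n) (0≤inv n)) (p≤q⇒0≤q-p bound)) (0≤* (nonNegative⁻¹ c) (0≤* (0≤inv n) (0≤inv n))))
    (begin
      y (suc n)                                ≡⟨ lem₁ (y n) (y (suc n)) ⟩
      y n + (y (suc n) - y n) * (1ℚ * 1ℚ)      ≡⟨ lem₂ (y n) (y (suc n)) (inv n) ⟩
      Φ 1ℚ                                     ≡⟨ cong Φ inv*≡1 ⟨
      Φ (inv n * (ι n + ι 1))                  ≡⟨ lem₃ (y n) (y (suc n)) (inv n) (ι n) ⟩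
      _ ∎)
    where
    open ≡-Reasoning
    Φ : ℚ → ℚ
    Φ o = y n + (y (suc n) - y n) * (o * o) + c * inv n - c * inv n * o
    inv*≡1 : inv n * (ι n + ι 1) ≡ 1ℚ
    inv*≡1 = trans (cong (inv n *_) (sym (ι-suc n))) (inv*suc n)
    lem₁ : ∀ y y′ → y′ ≡ y + (y′ - y) * (1ℚ * 1ℚ)
    lem₁ = solve-∀ ℚ-ring
    lem₂ : ∀ y y′ x → y + (y′ - y) * (1ℚ * 1ℚ) ≡ y + (y′ - y) * (1ℚ * 1ℚ) + + 1 / 24 * x - + 1 / 24 * x * 1ℚ
    lem₂ = solve-∀ ℚ-ring
    lem₃ = ring-solve 4 (λ y y′ x m → y ⊕ (y′ ⊖ y) ⊗ (x ⊗ (m ⊕ nat 1) ⊗ (x ⊗ (m ⊕ nat 1))) ⊕ Κ (+ 1 / 24) ⊗ x ⊖ Κ (+ 1 / 24) ⊗ x ⊗ (x ⊗ (m ⊕ nat 1))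
      ≐ y ⊕ Κ (+ 1 / 24) ⊗ x ⊕ (x ⊗ x ⊗ ((m ⊕ nat 1) ⊗ (m ⊕ nat 1) ⊗ (y′ ⊖ y) ⊖ Κ (+ 1 / 24) ⊗ (m ⊕ nat 2)) ⊕ Κ (+ 1 / 24) ⊗ (x ⊗ x))) refl

  -- The index starts at 1 because y₀ = y₁ = 1 gives δ₀ = 0. The two parts feed each other:
  -- positivity of y propagates the bound on δ, and that bound makes y increase.
  invariant : ∀ n → 1ℚ ≤ y (suc n) × c * (ι (suc n) + ι 2) ≤ δ (suc n)
  invariant zero = ≤-reflexive (sym y₁) , ≤-reflexive (sym δ₁)
    where
    y₁ : y 1 ≡ 1ℚ
    y₁ = cong ((ι 1 + ι 1) *_) v₁
    lem : ∀ x → x ≡ + 1 / 64 * (c₂ (τ 0) * x - c₁ (τ 0) * ½ + c₀ (τ 0) * 1ℚ) + + 11 / 32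
    lem = solve-∀ ℚ-ring
    v₂ : v 2 ≡ + 11 / 32
    v₂ = trans (lem (v 2)) (trans (cong₂ (λ p r → + 1 / 64 * (c₂ (τ 0) * v 2 - c₁ (τ 0) * p + c₀ (τ 0) * r) + + 11 / 32) (sym v₁) (sym v₀))
      (cong (λ x → + 1 / 64 * x + + 11 / 32) (v-rec 0)))
    δ₁ : δ 1 ≡ c * (ι 1 + ι 2)
    δ₁ = cong₂ (λ p r → (ι 1 + ι 1) * (ι 1 + ι 1) * ((ι 2 + ι 1) * p - (ι 1 + ι 1) * r)) v₂ v₁
  invariant (suc n) = let 1≤y , bound = invariant n
                          1≤y′ = ≤-trans 1≤y (≤-trans (≤-by-diff (c * inv (suc n)) (0≤* (nonNegative⁻¹ c) (0≤inv (suc n))) refl) (δ-bound⇒increment (suc n) bound)) in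
    1≤y′ , δ-step (suc n) (≤-trans (0≤ι 1) 1≤y′) bound

  increment : ∀ n → y (suc n) + c * inv (suc n) ≤ y (suc (suc n))
  increment n = δ-bound⇒increment (suc n) (proj₂ (invariant n))

  0≤y : ∀ n → 0ℚ ≤ y (suc n)
  0≤y n = ≤-trans (0≤ι 1) (proj₁ (invariant n))

  -- All increments are replaced by the common lower bound at N, so that j steps add up to a
  -- product.
  y-growth : ∀ n N j → n +ℕ j ≤ℕ N → y (suc n) + ι j * (c * inv N) ≤ y (suc n +ℕ j)
  y-growth n N zero _ = ≤-reflexive (trans (lem (y (suc n)) (c * inv N)) (cong y (sym (ℕₚ.+-identityʳ (suc n)))))
    where
    lem : ∀ p q → p + ι 0 * q ≡ p
    lem = solve-∀ ℚ-ring
  y-growth n N (suc j) le = ≤-trans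
    (≤-reflexive (trans (cong (λ k → y (suc n) + k * (c * inv N)) (ι-suc j)) (lem (y (suc n)) (ι j) (c * inv N))))
    (≤-trans (+-mono-≤ (y-growth n N j (ℕₚ.≤-trans (ℕₚ.+-monoʳ-≤ n (ℕₚ.n≤1+n j)) le))
        (*-monoˡ-≤-nonNeg c {{nonNegative (nonNegative⁻¹ c)}} (inv-anti-≤ (subst (_≤ℕ N) (ℕₚ.+-suc n j) le))))
      (≤-trans (increment (n +ℕ j)) (≤-reflexive (cong y (sym (ℕₚ.+-suc (suc n) j))))))
    where
    lem : ∀ p j q → p + (j + ι 1) * q ≡ p + j * q + q
    lem = solve-∀ ℚ-ring

  y-mono : ∀ n j → y (suc n) ≤ y (suc n +ℕ j)
  y-mono n j = ≤-trans
    (≤-by-diff (ι j * (c * inv (n +ℕ j))) (0≤* (0≤ι j) (0≤* (nonNegative⁻¹ c) (0≤inv (n +ℕ j)))) refl)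
    (y-growth n (n +ℕ j) j ℕₚ.≤-refl)

  -- There are n+1 increments, each at least c/(2n+2), for a total of c/2.
  y-doubling : ∀ n → y (suc n) + + 1 / 48 ≤ y (suc n +ℕ suc n)
  y-doubling n = ≤-trans (≤-reflexive (cong (λ x → y (suc n) + x) (sym eq))) (y-growth n (n +ℕ suc n) (suc n) ℕₚ.≤-refl)
    where
    open ≡-Reasoning
    lem : ∀ m t → (m + ι 1) * (+ 1 / 24 * t) ≡ + 1 / 48 * (t * (ι 2 * m + ι 2))
    lem = solve-∀ ℚ-ring
    eq : ι (suc n) * (c * inv (n +ℕ suc n)) ≡ + 1 / 48
    eq = begin
      ι (suc n) * (c * inv (n +ℕ suc n))      ≡⟨ cong₂ (λ m k → m * (c * inv k)) (ι-suc n) (ℕₚ.+-suc n n) ⟩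
      (ι n + ι 1) * (c * inv (suc (n +ℕ n)))  ≡⟨ cong (λ t → (ι n + ι 1) * (c * t)) (inv-suc-double n) ⟩
      (ι n + ι 1) * (c * θ n)                 ≡⟨ lem (ι n) (θ n) ⟩
      + 1 / 48 * (θ n * (ι 2 * ι n + ι 2))    ≡⟨ cong (+ 1 / 48 *_) (θ-inverse n) ⟩
      + 1 / 48 * 1ℚ                           ≡⟨ *-identityʳ (+ 1 / 48) ⟩
      + 1 / 48 ∎

  -- Halving the index lowers the logarithm by 1 and 48 y by at least 1; for odd indices
  -- monotonicity covers the remaining step.
  log₂≤48y : ∀ n → ι ⌊log₂ suc n ⌋ ≤ ι 48 * y (suc n)
  log₂≤48y = <-rec _ step
    where
    step : ∀ n → (∀ {m} → m ℕ.< n → ι ⌊log₂ suc m ⌋ ≤ ι 48 * y (suc m)) → ι ⌊log₂ suc n ⌋ ≤ ι 48 * y (suc n)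
    step zero    _  = 0≤* (0≤ι 48) (0≤y 0)
    step (suc k) ih = ≤-trans (ι-mono log≤)
      (≤-trans (≤-reflexive (ι-suc ⌊log₂ half ⌋))
      (≤-trans (+-monoˡ-≤ (ι 1) (ih (s≤s (ℕₚ.⌊n/2⌋≤n k))))
      (≤-trans (≤-reflexive (lem (y half)))
        (*-monoˡ-≤-nonNeg (ι 48) {{nonNegative (0≤ι 48)}} (≤-trans (y-doubling ⌊ k /2⌋) y-half+half≤)))))
      where
      -- This is ⌊n/2⌋ by computation, in the successor form that the bounds on y require.
      half = suc ⌊ k /2⌋
      n = suc (suc k)
      log≤ : ⌊log₂ n ⌋ ≤ℕ suc ⌊log₂ half ⌋
      log≤ = ℕₚ.≤-trans (ℕₚ.m≤n+m∸n ⌊log₂ n ⌋ 1) (s≤s (ℕₚ.≤-reflexive (sym (⌊log₂⌊n/2⌋⌋≡⌊log₂n⌋∸1 n))))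
      lem : ∀ y → ι 48 * y + ι 1 ≡ ι 48 * (y + + 1 / 48)
      lem = solve-∀ ℚ-ring
      half+half≤n : half +ℕ half ≤ℕ n
      half+half≤n = ℕₚ.≤-trans (ℕₚ.+-monoʳ-≤ half (ℕₚ.⌊n/2⌋≤⌈n/2⌉ n)) (ℕₚ.≤-reflexive (ℕₚ.⌊n/2⌋+⌈n/2⌉≡n n))
      y-half+half≤ : y (half +ℕ half) ≤ y n
      y-half+half≤ = ≤-trans (y-mono (⌊ k /2⌋ +ℕ half) (n ∸ (half +ℕ half))) (≤-reflexive (cong y (ℕₚ.m+[n∸m]≡n half+half≤n)))

-- From the linear form to the distance

ratio-* : ∀ p q (q≢0 : q ≢ 0ℚ) → q * ratio p q q≢0 ≡ p
ratio-* p q q≢0 = trans (lem q p _) (trans (cong (p *_) (*-inverseʳ q {{≢-nonZero q≢0}})) (*-identityʳ p))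
  where
  lem : ∀ q p r → q * (p * r) ≡ p * (q * r)
  lem = solve-∀ ℚ-ring

-- L ≤ 48 y can be multiplied by X only if X ≥ 0; otherwise L X ≤ 0 already. Here 5/4 = ½(1 + 3/2),
-- with 1 for the truncation error and 3/2 for the sum, and 60 = 48 · 5/4.
scaled-bound : ∀ {L y X} → 0ℚ ≤ L → L ≤ ι 48 * y → y * X ≤ + 5 / 4 → L * X ≤ ι 60
scaled-bound {L} {y} {X} 0≤L L≤48y yX≤ with ≤-total 0ℚ X
... | inj₁ 0≤X = ≤-trans (*-monoʳ-≤-nonNeg X {{nonNegative 0≤X}} L≤48y)
  (≤-trans (≤-reflexive (*-assoc (ι 48) y X)) (*-monoˡ-≤-nonNeg (ι 48) {{nonNegative (0≤ι 48)}} yX≤))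
... | inj₂ X≤0 = ≤-trans (*-monoˡ-≤-nonNeg L {{nonNegative 0≤L}} X≤0) (≤-trans (≤-reflexive (*-zeroʳ L)) (0≤ι 60))

O⇒eventually-small : ∀ {u} → O[1/M] u → ∀ s → 0ℚ ≤ s → ∃[ M₀ ] ∀ j → s * ∣ u (M₀ +ℕ j) ∣ ≤ 1ℚ
O⇒eventually-small {u} (K , bound) s 0≤s = M₀ , λ j →
  ≤-trans (*-monoˡ-≤-nonNeg s {{nonNegative 0≤s}} (bound (M₀ +ℕ j)))
  (≤-trans (≤-reflexive (sym (*-assoc s K (inv (M₀ +ℕ j)))))
  (≤-trans (*-monoʳ-≤-nonNeg (inv (M₀ +ℕ j)) {{nonNegative (0≤inv (M₀ +ℕ j))}}
      (≤-trans (p≤ι∣↥p∣ (s * K)) (ι-mono (ℕₚ.≤-trans (ℕₚ.m≤m+n M₀ j) (ℕₚ.n≤1+n (M₀ +ℕ j))))))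
    (≤-reflexive (trans (*-comm _ (inv (M₀ +ℕ j))) (inv*suc (M₀ +ℕ j))))))
  where M₀ = ℤ.∣ ↥ (s * K) ∣

module Conclusion (a b : ℕ → ℚ) (a-rec : Recurrence a) (b-rec : Recurrence b)
  (a₀ : a 0 ≡ ι 1) (a₁ : a 1 ≡ ι 8) (b₀ : b 0 ≡ 0ℚ) (b₁ : b 1 ≡ ι 1) where

  v u : ℕ → ℚ
  v n = a n * 16⁻^ n
  u n = b n * 16⁻^ n

  v-rec : NormalisedRecurrence v
  v-rec = normalise-recurrence a a-rec
  v₀ : v 0 ≡ 1ℚ
  v₀ = cong (_* 16⁻^ 0) a₀
  v₁ : v 1 ≡ ½
  v₁ = cong (_* 16⁻^ 1) a₁

  open Growth v v-rec v₀ v₁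
  open Remainder v u v-rec (normalise-recurrence b b-rec) v₀ v₁ (cong (_* 16⁻^ 0) b₀) (cong (_* 16⁻^ 1) b₁)

  a≢0 : ∀ n → a (suc n) ≢ 0ℚ
  a≢0 n a≡0 = 1≰0 (subst (1ℚ ≤_) y≡0 (proj₁ (invariant n)))
    where
    y≡0 : y (suc n) ≡ 0ℚ
    y≡0 = trans (cong (λ x → (ι (suc n) + ι 1) * (x * 16⁻^ (suc n))) a≡0) (lem (ι (suc n)) (16⁻^ (suc n)))
      where
      lem : ∀ m q → (m + ι 1) * (0ℚ * q) ≡ 0ℚ
      lem = solve-∀ ℚ-ring
    1≰0 : ¬ (1ℚ ≤ 0ℚ)
    1≰0 (*≤* (ℤ.+≤+ ()))

  -- x is bₙ/aₙ, known only through its product with aₙ, so no proof of aₙ ≠ 0 enters the algebra.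
  -- The ½ turns the coefficients 7/8 and 2 of `R` into 7/16 and 1.
  y*error : ∀ n M x → a n * x ≡ b n →
    y n * (+ 7 / 16 * ζ M - x) ≡ ½ * ((ι n + ι 1) * R n M + (ι n + ι 1) * sum (T n) M)
  y*error n M x ax≡b = trans (lem₁ (ι n) (a n) (16⁻^ n) (ζ M) x)
    (trans (cong (λ p → (ι n + ι 1) * (+ 7 / 16 * ζ M * (a n * 16⁻^ n) - p * 16⁻^ n)) ax≡b)
      (lem₂ (ι n) (a n) (16⁻^ n) (ζ M) (b n) (sum (T n) M)))
    where
    lem₁ : ∀ m a q z x → (m + ι 1) * (a * q) * (+ 7 / 16 * z - x) ≡ (m + ι 1) * (+ 7 / 16 * z * (a * q) - a * x * q)
    lem₁ = solve-∀ ℚ-ring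
    lem₂ = ring-solve 6 (λ m a q z b s → (m ⊕ nat 1) ⊗ (Κ (+ 7 / 16) ⊗ z ⊗ (a ⊗ q) ⊖ b ⊗ q)
      ≐ Κ ½ ⊗ ((m ⊕ nat 1) ⊗ (Κ (+ 7 / 8) ⊗ z ⊗ (a ⊗ q) ⊖ nat 2 ⊗ (b ⊗ q) ⊖ s) ⊕ (m ⊕ nat 1) ⊗ s)) refl

  module _ (n : ℕ) (x : ℚ) (ax≡b : a (suc n) * x ≡ b (suc n)) where
    private
      m = ι (suc n) + ι 1
      L = ι ⌊log₂ suc n ⌋
      0≤m : 0ℚ ≤ m
      0≤m = 0≤+ (0≤ι (suc n)) (0≤ι 1)
      0≤L : 0ℚ ≤ L
      0≤L = 0≤ι ⌊log₂ suc n ⌋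
      small = O⇒eventually-small (O-R (suc n)) m 0≤m
      M₀ = proj₁ small

      mR≤1 : ∀ j → m * R (suc n) (M₀ +ℕ j) ≤ 1ℚ
      mR≤1 j = ≤-trans (*-monoˡ-≤-nonNeg m {{nonNegative 0≤m}} (p≤∣p∣ _)) (proj₂ small j)

      -mR≤1 : ∀ j → - (m * R (suc n) (M₀ +ℕ j)) ≤ 1ℚ
      -mR≤1 j = ≤-trans (≤-reflexive (neg-distribʳ-* m r))
        (≤-trans (*-monoˡ-≤-nonNeg m {{nonNegative 0≤m}} (≤-trans (p≤∣p∣ (- r)) (≤-reflexive (∣-p∣≡∣p∣ r)))) (proj₂ small j))
        where r = R (suc n) (M₀ +ℕ j)

    upper : ∀ j → L * (+ 7 / 16 * ζ (M₀ +ℕ j) - x) ≤ ι 60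
    upper j = scaled-bound {L} {y (suc n)} 0≤L (log₂≤48y n)
      (≤-trans (≤-reflexive (y*error (suc n) (M₀ +ℕ j) x ax≡b))
        (*-monoˡ-≤-nonNeg ½ {{nonNegative (nonNegative⁻¹ ½)}} (+-mono-≤ (mR≤1 j) ([n+1]sumT≤3/2 (suc n) (M₀ +ℕ j)))))

    -- `upper` reaches only the truncations beyond M₀, which depends on n; the partial sums
    -- increase, so a smaller M is dominated by M₀ + M.
    upper-all : ∀ M → L * (+ 7 / 16 * ζ M - x) ≤ ι 60
    upper-all M = ≤-trans
      (*-monoˡ-≤-nonNeg L {{nonNegative 0≤L}} (+-monoˡ-≤ (- x) (*-monoˡ-≤-nonNeg (+ 7 / 16)
        (≤-trans (zeta3-mono M M₀) (≤-reflexive (cong ζ (ℕₚ.+-comm M M₀)))))))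
      (upper M)

    -- With the sign reversed the sum enters negatively and its nonnegativity is enough, so only the
    -- truncation error contributes, at most ½.
    lower : ∃[ M ] L * (x - + 7 / 16 * ζ M) ≤ ι 60
    lower = M₀ +ℕ 0 , scaled-bound {L} {y (suc n)} 0≤L (log₂≤48y n)
      (≤-trans (≤-reflexive (trans (lem₁ (y (suc n)) x (+ 7 / 16 * ζ (M₀ +ℕ 0)))
          (trans (cong -_ (y*error (suc n) (M₀ +ℕ 0) x ax≡b)) (lem₂ (m * R (suc n) (M₀ +ℕ 0)) (m * sum (T (suc n)) (M₀ +ℕ 0))))))
        (≤-trans (*-monoˡ-≤-nonNeg ½ {{nonNegative (nonNegative⁻¹ ½)}}
            (+-mono-≤ (-mR≤1 0) (neg-antimono-≤ (0≤* 0≤m (0≤sumT (suc n) (M₀ +ℕ 0))))))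
          -- 5/4 - ½, to fit the common hypothesis of `scaled-bound`.
          (≤-by-diff (+ 3 / 4) (nonNegative⁻¹ (+ 3 / 4)) refl)))
      where
      lem₁ : ∀ y x z → y * (x - z) ≡ - (y * (z - x))
      lem₁ = solve-∀ ℚ-ring
      lem₂ : ∀ r s → - (½ * (r + s)) ≡ ½ * (- r + - s)
      lem₂ = solve-∀ ℚ-ring

    scaled-distance : ScaledDistZeta3≤ L (+ 7 / 16) x (ι 60)
    scaled-distance = (λ M → subst (λ z → L * (+ 7 / 16 * z - x) ≤ ι 60) (ζ≡zeta3Partial M) (upper-all M))
      , λ δ 0<δ → let M , bound = lower in M ,
          ≤-trans (subst (λ z → L * (x - + 7 / 16 * z) ≤ ι 60) (ζ≡zeta3Partial M) bound)
            (≤-trans (≤-reflexive (sym (+-identityʳ (ι 60)))) (+-monoʳ-≤ (ι 60) (<⇒≤ 0<δ)))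

theorem5 : (a b : ℕ → ℚ) → Recurrence a → Recurrence b →
    a 0 ≡ ℕ→ℚ 1 → a 1 ≡ ℕ→ℚ 8 → b 0 ≡ 0ℚ → b 1 ≡ ℕ→ℚ 1 →
    ∃[ C ] ∃[ N ] (∀ (n : ℕ) → N ≤ℕ n →
    Σ (a n ≢ 0ℚ) (λ aₙ≢0 →
    ScaledDistZeta3≤ (ℕ→ℚ ⌊log₂ n ⌋) ((+ 7) / 16) (ratio (b n) (a n) aₙ≢0) C))
-- The threshold is 1 because the invariant, and with it aₙ ≠ 0, is available from index 1 on.
theorem5 a b a-rec b-rec a₀ a₁ b₀ b₁ = ι 60 , 1 , bound
  where
  open Conclusion a b a-rec b-rec a₀ a₁ b₀ b₁
  bound : ∀ n → 1 ≤ℕ n → Σ (a n ≢ 0ℚ) (λ aₙ≢0 →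
    ScaledDistZeta3≤ (ι ⌊log₂ n ⌋) (+ 7 / 16) (ratio (b n) (a n) aₙ≢0) (ι 60))
  bound (suc n) _ = a≢0 n , scaled-distance n (ratio (b (suc n)) (a (suc n)) (a≢0 n)) (ratio-* (b (suc n)) (a (suc n)) (a≢0 n))
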